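{- The integrality gap of the subtour LP restricted to symmetric circulant TSP instances is exactly $2$; that is, $$\sup_{n}\ \sup_{(c_1,\dots,c_d)\in\mathbb{R}^d_{\ge 0}}\frac{\mathrm{TSPOPT}(c_1,\dots,c_d)}{\mathrm{LPOPT}(c_1,\dots,c_d)}=2.$$
   Context: For $n\ge 3$ let $d=\lfloor n/2\rfloor$. A symmetric circulant TSP instance on $K_n$ (vertices $[n]$, arithmetic mod $n$) is given by stripe costs $c_1,\dots,c_d\ge0$: edge $\{i,j\}$ has cost $c_k$ where $k=\min\{(i-j)\bmod n,(j-i)\bmod n\}$. $\mathrm{TSPOPT}(c_1,\dots,c_d)$ is the minimum cost of a Hamiltonian cycle in $K_n$. $\mathrm{LPOPT}(c_1,\dots,c_d)$ is the optimal value of the subtour LP: minimize $\sum_{e}c_ex_e$ subject to $\sum_{e\in\delta(v)}x_e=2$ for all vertices $v$, $\sum_{e\in\delta(S)}x_e\ge2$ for all $\emptyset\neq S\subsetneq[n]$, $0\le x_e\le1$, where $\delta(S)$ is the set of edges with exactly one endpoint in $S$.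
   Formalization: The stripe costs and the LP variables are taken rational instead of real, and the supremum is stated as an upper bound of 2 on the ratio together with instances whose ratio exceeds 2−ε for every rational ε > 0. -}

module Defs where

open import Data.Nat as ℕ using (ℕ; zero; suc; _∸_; _⊓_; _/_)
open import Data.Nat.Properties using (_<?_; _≤?_)
open import Data.Bool using (Bool; true; false; _∧_; not; if_then_else_)
open import Data.Fin using (Fin; zero; suc; toℕ; fromℕ<)
open import Data.Fin.Permutation using (Permutation′; _⟨$⟩ʳ_)
open import Data.Product using (_×_; ∃)
open import Relation.Nullary using (yes; no; ¬_)
open import Relation.Binary.PropositionalEquality using (_≡_)
open import Data.Rational using (ℚ; 0ℚ; 1ℚ; _+_; _*_; _≤_; _<_)

Σ : (n : ℕ) → (Fin n → ℚ) → ℚ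
Σ zero    f = 0ℚ
Σ (suc n) f = f zero + Σ n (λ i → f (suc i))

2ℚ : ℚ
2ℚ = 1ℚ + 1ℚ

diffMod : (n : ℕ) → Fin n → Fin n → ℕ
diffMod n i j with (ℕ._+_ (toℕ i) n ∸ toℕ j) <? n
... | yes _ = ℕ._+_ (toℕ i) n ∸ toℕ j
... | no  _ = (ℕ._+_ (toℕ i) n ∸ toℕ j) ∸ n

stripe : (n : ℕ) → Fin n → Fin n → ℕ
stripe n i j = diffMod n i j ⊓ diffMod n j i

-- stripe costs c_1..c_d are given as c : Fin d → ℚ with c_k = c (k-1);
-- this reads entry k of (c_1,...,c_d) (1-based), 0 out of range (never used for i ≠ j)
stripeCost : (d : ℕ) → (Fin d → ℚ) → ℕ → ℚ
stripeCost zero    c k             = 0ℚ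
stripeCost (suc d) c zero          = 0ℚ
stripeCost (suc d) c (suc zero)    = c zero
stripeCost (suc d) c (suc (suc k)) = stripeCost d (λ i → c (suc i)) (suc k)

edgeCost : (n : ℕ) → (Fin (n / 2) → ℚ) → Fin n → Fin n → ℚ
edgeCost n c i j = stripeCost (n / 2) c (stripe n i j)

next : {n : ℕ} → Fin n → Fin n
next {suc m} k with suc (toℕ k) <? suc m
... | yes p = fromℕ< p
... | no  _ = zero

-- Hamiltonian cycle given by a cyclic ordering σ(0), σ(1), ..., σ(n-1), σ(0)
tourCost : (n : ℕ) → (Fin (n / 2) → ℚ) → Permutation′ n → ℚ
tourCost n c σ = Σ n (λ k → edgeCost n c (σ ⟨$⟩ʳ k) (σ ⟨$⟩ʳ next k))

-- LP points: x i j is the value on edge {i,j}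
LPPoint : ℕ → Set
LPPoint n = Fin n → Fin n → ℚ

Σedges : (n : ℕ) → (Fin n → Fin n → ℚ) → ℚ
Σedges n f = Σ n (λ i → Σ n (λ j → if toℕ i ℕ.<ᵇ toℕ j then f i j else 0ℚ))

lpCost : (n : ℕ) → (Fin (n / 2) → ℚ) → LPPoint n → ℚ
lpCost n c x = Σedges n (λ i j → edgeCost n c i j * x i j)

cut : (n : ℕ) → LPPoint n → (Fin n → Bool) → ℚ
cut n x S = Σ n (λ i → Σ n (λ j → if S i ∧ not (S j) then x i j else 0ℚ))

-- feasibility for the subtour LP (x symmetric with zero diagonal encodes a vector on edges)
record SubtourFeasible (n : ℕ) (x : LPPoint n) : Set where
  field
    symmetric : ∀ i j → x i j ≡ x j i
    diagonal  : ∀ i → x i i ≡ 0ℚ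
    lower     : ∀ i j → 0ℚ ≤ x i j
    upper     : ∀ i j → x i j ≤ 1ℚ
    degree    : ∀ v → Σ n (λ j → x v j) ≡ 2ℚ
    subtour   : ∀ (S : Fin n → Bool) → (∃ λ i → S i ≡ true) → (∃ λ j → S j ≡ false) →
                2ℚ ≤ cut n x S

{-# OPTIONS --safe #-}
-- Upper bound. Let a be the cheapest stripe not divisible by g, and d = gcd g a. From a walk
-- through the residues mod d one obtains a walk through the residues mod g by traversing the
-- cosets of a alternately upwards and downwards. Starting from g = 1 this is the greedy
-- construction, and its cost is dominated by the LP: for g > 1 the subtour constraints of the
-- residue classes mod g give weight at least g to the edges joining different classes. If a is
-- the cheapest stripe of all and d = gcd n a, the walk mod d extends to a Hamiltonian cycle of the
-- cylinder {walk} × {multiples of a}: a serpentine through all rows but one, and back along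
-- that row. Such a cycle uses the walk twice and is otherwise as cheap as possible.
--
-- Lower bound. For n = 2g with g even, give cost 1 to the stripe 1, cost 0 to the diameters and
-- cost g to the rest. Weight 1/2 on the n-cycle and 1 on the diameters is feasible of cost g. In a
-- tour, let kᵦ be the number of steps between the rungs {b, b+g} and {b+1, b+1+g}. A parity
-- argument shows that every kᵦ is even, and by connectivity at most one of them vanishes, so a
-- tour costs at least 2g - 2.
module Submission where

-- The induction on `g` works because the bound on a walk carries a free parameter. For every `λ′`
-- not exceeding the cost of any stripe not divisible by `g`, twice the cost of the walk, lowered by
-- `λ′` per step, is at most `W g λ′`: the LP cost of the edges between residue classes, lowered
-- alike and summed over ordered pairs. At `λ′ = κ a` the new steps along `a` are free, so the bound
-- passes from `d` to `g` without loss. Lowering `λ′` further adds the difference `g - 1` times to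
-- the walk and, by the subtour constraints, at least `g` times to the LP. If `C` is the lowered
-- cost of the final walk, the tour costs `2C + nκ` and the LP at least `C + nκ`.
--
-- Evenness of `g` is essential in the lower bound: for odd `g`, alternating rungs and cycle edges
-- gives a tour of cost `g`, no more than the LP point. For even `g` the same path returns to the
-- wrong end of its first rung, and the parity argument shows that every tour pays for this.

open import Defs

-- Finite sums of rationals and the cyclic successor.

module Sums where

  open import Data.Nat as ℕ using (ℕ; zero; suc)
  import Data.Nat.Properties as ℕ
  open import Data.Bool using (Bool; T; true; false; not; if_then_else_)
  open import Data.Fin using (Fin; zero; suc; toℕ; inject₁; fromℕ)
  import Data.Fin.Properties as Fin
  open import Data.Empty using (⊥-elim)
  open import Relation.Nullary using (yes; no)
  open import Relation.Binary.PropositionalEquality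
  open import Data.Rational using (ℚ; 0ℚ; 1ℚ; _+_; _*_; _-_; -_; _≤_; nonNegative)
  import Data.Rational.Properties as ℚ
  open import Data.Rational.Solver using (module +-*-Solver)
  open +-*-Solver using (solve; _:+_; _:*_; _:-_; _:=_; con)

  -- Repeated addition makes `ι` unfold together with `Σ`; the comparison with a fraction of
  -- denominator 1 is left to the Archimedean property.
  ι : ℕ → ℚ
  ι zero    = 0ℚ
  ι (suc n) = 1ℚ + ι n

  0≤1 : 0ℚ ≤ 1ℚ
  0≤1 = ℚ.nonNegative⁻¹ 1ℚ

  p≤p+q : ∀ {p q} → 0ℚ ≤ q → p ≤ p + q
  p≤p+q {p} {q} 0≤q = subst (_≤ p + q) (ℚ.+-identityʳ p) (ℚ.+-monoʳ-≤ p 0≤q)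

  q≤p+q : ∀ {p q} → 0ℚ ≤ p → q ≤ p + q
  q≤p+q {p} {q} 0≤p = subst (_≤ p + q) (ℚ.+-identityˡ q) (ℚ.+-monoˡ-≤ q 0≤p)

  +-nonneg : ∀ {p q} → 0ℚ ≤ p → 0ℚ ≤ q → 0ℚ ≤ p + q
  +-nonneg 0≤p 0≤q = ℚ.≤-trans 0≤p (p≤p+q 0≤q)

  *-nonneg : ∀ {p q} → 0ℚ ≤ p → 0ℚ ≤ q → 0ℚ ≤ p * q
  *-nonneg {p} {q} 0≤p 0≤q =
    subst (_≤ p * q) (ℚ.*-zeroʳ p) (ℚ.*-monoˡ-≤-nonNeg p {{nonNegative 0≤p}} 0≤q)

  *-mono-≤ˡ : ∀ {r p q} → 0ℚ ≤ r → p ≤ q → r * p ≤ r * q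
  *-mono-≤ˡ {r} 0≤r = ℚ.*-monoˡ-≤-nonNeg r {{nonNegative 0≤r}}

  p≤q⇒0≤q-p : ∀ {p q} → p ≤ q → 0ℚ ≤ q - p
  p≤q⇒0≤q-p {p} {q} p≤q = subst (_≤ q - p) (ℚ.+-inverseʳ p) (ℚ.+-monoˡ-≤ (- p) p≤q)

  ι-nonneg : ∀ n → 0ℚ ≤ ι n
  ι-nonneg zero    = ℚ.≤-refl
  ι-nonneg (suc n) = +-nonneg 0≤1 (ι-nonneg n)

  ι-+ : ∀ m n → ι (m ℕ.+ n) ≡ ι m + ι n
  ι-+ zero    n = sym (ℚ.+-identityˡ (ι n))
  ι-+ (suc m) n = trans (cong (1ℚ +_) (ι-+ m n)) (sym (ℚ.+-assoc 1ℚ (ι m) (ι n)))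

  ι-mono : ∀ {m n} → m ℕ.≤ n → ι m ≤ ι n
  ι-mono {n = n} ℕ.z≤n = ι-nonneg n
  ι-mono (ℕ.s≤s m≤n)   = ℚ.+-monoʳ-≤ 1ℚ (ι-mono m≤n)

  Σ-cong : ∀ n {f g : Fin n → ℚ} → (∀ i → f i ≡ g i) → Σ n f ≡ Σ n g
  Σ-cong zero    eq = refl
  Σ-cong (suc n) eq = cong₂ _+_ (eq zero) (Σ-cong n (λ i → eq (suc i)))

  Σ-mono : ∀ n {f g : Fin n → ℚ} → (∀ i → f i ≤ g i) → Σ n f ≤ Σ n g
  Σ-mono zero    le = ℚ.≤-refl
  Σ-mono (suc n) le = ℚ.+-mono-≤ (le zero) (Σ-mono n (λ i → le (suc i)))

  Σ-const : ∀ n q → Σ n (λ _ → q) ≡ ι n * q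
  Σ-const zero    q = sym (ℚ.*-zeroˡ q)
  Σ-const (suc n) q = trans (cong (q +_) (Σ-const n q))
    (solve 2 (λ a b → b :+ a :* b := (con 1ℚ :+ a) :* b) refl (ι n) q)

  Σ-zero : ∀ n → Σ n (λ _ → 0ℚ) ≡ 0ℚ
  Σ-zero n = trans (Σ-const n 0ℚ) (ℚ.*-zeroʳ (ι n))

  Σ-nonneg : ∀ n {f : Fin n → ℚ} → (∀ i → 0ℚ ≤ f i) → 0ℚ ≤ Σ n f
  Σ-nonneg n {f} 0≤f = subst (_≤ Σ n f) (Σ-zero n) (Σ-mono n 0≤f)

  Σ-+ : ∀ n (f g : Fin n → ℚ) → Σ n (λ i → f i + g i) ≡ Σ n f + Σ n g
  Σ-+ zero    f g = refl
  Σ-+ (suc n) f g = trans (cong (f zero + g zero +_) (Σ-+ n _ _))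
    (solve 4 (λ a b c d → (a :+ b) :+ (c :+ d) := (a :+ c) :+ (b :+ d)) refl
      (f zero) (g zero) _ _)

  Σ-*ˡ : ∀ n q (f : Fin n → ℚ) → Σ n (λ i → q * f i) ≡ q * Σ n f
  Σ-*ˡ zero    q f = sym (ℚ.*-zeroʳ q)
  Σ-*ˡ (suc n) q f = trans (cong (q * f zero +_) (Σ-*ˡ n q _)) (sym (ℚ.*-distribˡ-+ q _ _))

  Σ-swap : ∀ m n (f : Fin m → Fin n → ℚ) →
    Σ m (λ i → Σ n (f i)) ≡ Σ n (λ j → Σ m (λ i → f i j))
  Σ-swap zero    n f = sym (Σ-zero n)
  Σ-swap (suc m) n f = trans (cong (Σ n (f zero) +_) (Σ-swap m n _)) (sym (Σ-+ n _ _))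

  Σ-last : ∀ n (f : Fin (suc n) → ℚ) → Σ (suc n) f ≡ Σ n (λ i → f (inject₁ i)) + f (fromℕ n)
  Σ-last zero    f = ℚ.+-comm (f zero) 0ℚ
  Σ-last (suc n) f = trans (cong (f zero +_) (Σ-last n (λ i → f (suc i))))
    (sym (ℚ.+-assoc (f zero) _ _))

  Σ-≥-term : ∀ n {f : Fin n → ℚ} → (∀ i → 0ℚ ≤ f i) → ∀ i → f i ≤ Σ n f
  Σ-≥-term (suc n) 0≤f zero    = p≤p+q (Σ-nonneg n (λ i → 0≤f (suc i)))
  Σ-≥-term (suc n) 0≤f (suc i) =
    ℚ.≤-trans (Σ-≥-term n (λ i → 0≤f (suc i)) i) (q≤p+q (0≤f zero))

  Σ-≥-two-terms : ∀ n {f : Fin n → ℚ} → (∀ i → 0ℚ ≤ f i) → ∀ {i j} → i ≢ j → f i + f j ≤ Σ n f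
  Σ-≥-two-terms (suc n) 0≤f {zero}  {zero}  i≢j = ⊥-elim (i≢j refl)
  Σ-≥-two-terms (suc n) {f} 0≤f {zero}  {suc j} i≢j =
    ℚ.+-monoʳ-≤ (f zero) (Σ-≥-term n (λ i → 0≤f (suc i)) j)
  Σ-≥-two-terms (suc n) {f} 0≤f {suc i} {zero} i≢j =
    subst (_≤ Σ (suc n) f) (ℚ.+-comm (f zero) (f (suc i)))
      (ℚ.+-monoʳ-≤ (f zero) (Σ-≥-term n (λ i → 0≤f (suc i)) i))
  Σ-≥-two-terms (suc n) 0≤f {suc i} {suc j} i≢j =
    ℚ.≤-trans (Σ-≥-two-terms n (λ i → 0≤f (suc i)) (λ eq → i≢j (cong suc eq))) (q≤p+q (0≤f zero))

  Σ-single : ∀ n (f : Fin n → ℚ) k → (∀ i → i ≢ k → f i ≡ 0ℚ) → Σ n f ≡ f k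
  Σ-single (suc n) f zero    off = trans
    (cong (f zero +_) (trans (Σ-cong n (λ i → off (suc i) (λ ()))) (Σ-zero n)))
    (ℚ.+-identityʳ (f zero))
  Σ-single (suc n) f (suc k) off = trans
    (cong₂ _+_ (off zero (λ ()))
      (Σ-single n (λ i → f (suc i)) k (λ i i≢k → off (suc i) (λ eq → i≢k (Fin.suc-injective eq)))))
    (ℚ.+-identityˡ (f (suc k)))

  if-nonneg : ∀ b {p} → (b ≡ true → 0ℚ ≤ p) → 0ℚ ≤ (if b then p else 0ℚ)
  if-nonneg true  0≤p = 0≤p refl
  if-nonneg false 0≤p = ℚ.≤-refl

  if-mono : ∀ b b′ {p} → (b ≡ true → b′ ≡ true) → 0ℚ ≤ (if b′ then p else 0ℚ) →
    (if b then p else 0ℚ) ≤ (if b′ then p else 0ℚ)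
  if-mono true  true  b⇒b′ 0≤p = ℚ.≤-refl
  if-mono true  false b⇒b′ 0≤p with () ← b⇒b′ refl
  if-mono false b′    b⇒b′ 0≤p = 0≤p

  if-≤ : ∀ b {p} → 0ℚ ≤ p → (if b then p else 0ℚ) ≤ p
  if-≤ true  0≤p = ℚ.≤-refl
  if-≤ false 0≤p = 0≤p

  if-shift : ∀ b x e l m →
    (if b then x * (e - l) else 0ℚ) ≡ (if b then x * (e - m) else 0ℚ) + (m - l) * (if b then x else 0ℚ)
  if-shift true  = solve 4 (λ x e l m → x :* (e :- l) := x :* (e :- m) :+ (m :- l) :* x) refl
  if-shift false x e l m = solve 1 (λ k → con 0ℚ := con 0ℚ :+ k :* con 0ℚ) refl (m - l)

  Σ-≤-unique : ∀ n (b : Fin n → Bool) {q} → 0ℚ ≤ q → (∀ i j → b i ≡ true → b j ≡ true → i ≡ j) →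
    Σ n (λ i → if b i then q else 0ℚ) ≤ q
  Σ-≤-unique zero    b 0≤q uniq = 0≤q
  Σ-≤-unique (suc n) b {q} 0≤q uniq with b zero in b₀
  ... | true  = ℚ.≤-reflexive (trans (cong (q +_) (trans (Σ-cong n none) (Σ-zero n))) (ℚ.+-identityʳ q))
    where
    none : ∀ i → (if b (suc i) then q else 0ℚ) ≡ 0ℚ
    none i with b (suc i) in bᵢ
    ... | false = refl
    ... | true with () ← uniq zero (suc i) b₀ bᵢ
  ... | false = subst (_≤ q) (sym (ℚ.+-identityˡ _))
    (Σ-≤-unique n (λ i → b (suc i)) 0≤q
      (λ i j bᵢ bⱼ → Fin.suc-injective (uniq (suc i) (suc j) bᵢ bⱼ)))

  -- Made for sums over residue classes: an ordered pair of vertices leaves at most one class, and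
  -- leaves one only if it joins different classes.
  Σ-≤-if : ∀ n (b : Fin n → Bool) b′ {q} → 0ℚ ≤ q → (∀ i → b i ≡ true → b′ ≡ true) →
    (∀ i j → b i ≡ true → b j ≡ true → i ≡ j) →
    Σ n (λ i → if b i then q else 0ℚ) ≤ (if b′ then q else 0ℚ)
  Σ-≤-if n b true  0≤q b⇒b′ uniq = Σ-≤-unique n b 0≤q uniq
  Σ-≤-if n b false {q} 0≤q b⇒b′ uniq = ℚ.≤-reflexive (trans (Σ-cong n zero-term) (Σ-zero n))
    where
    zero-term : ∀ i → (if b i then q else 0ℚ) ≡ 0ℚ
    zero-term i with b i in bᵢ
    ... | false = refl
    ... | true with () ← b⇒b′ i bᵢ

  next-inject₁ : ∀ {m} (k : Fin m) → next (inject₁ k) ≡ suc k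
  next-inject₁ {m} k with suc (toℕ (inject₁ k)) ℕ.<? suc m
  ... | yes p = Fin.toℕ-injective (trans (Fin.toℕ-fromℕ< p) (cong suc (Fin.toℕ-inject₁ k)))
  ... | no ¬p = ⊥-elim (¬p (ℕ.s≤s (subst (ℕ._< m) (sym (Fin.toℕ-inject₁ k)) (Fin.toℕ<n k))))

  next-fromℕ : ∀ m → next (fromℕ m) ≡ zero
  next-fromℕ m with suc (toℕ (fromℕ m)) ℕ.<? suc m
  ... | yes p = ⊥-elim (ℕ.n≮n (suc m) (subst (λ k → suc k ℕ.< suc m) (Fin.toℕ-fromℕ m) p))
  ... | no _  = refl

  Σ-next : ∀ m (f : Fin (suc m) → Fin (suc m) → ℚ) →
    Σ (suc m) (λ k → f k (next k)) ≡ Σ m (λ k → f (inject₁ k) (suc k)) + f (fromℕ m) zero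
  Σ-next m f = trans (Σ-last m (λ k → f k (next k))) (cong₂ _+_
    (Σ-cong m (λ k → cong (f (inject₁ k)) (next-inject₁ k)))
    (cong (f (fromℕ m)) (next-fromℕ m)))

  ≡ᵇ≡true⇒≡ : ∀ {a b} → (a ℕ.≡ᵇ b) ≡ true → a ≡ b
  ≡ᵇ≡true⇒≡ {a} {b} eq = ℕ.≡ᵇ⇒≡ a b (subst T (sym eq) _)

  ≡⇒≡ᵇ≡true : ∀ {a b} → a ≡ b → (a ℕ.≡ᵇ b) ≡ true
  ≡⇒≡ᵇ≡true {a} {b} eq with a ℕ.≡ᵇ b | ℕ.≡⇒≡ᵇ a b eq
  ... | true | _ = refl

  ≢⇒≡ᵇ≡false : ∀ {a b} → a ≢ b → (a ℕ.≡ᵇ b) ≡ false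
  ≢⇒≡ᵇ≡false {a} {b} a≢b with a ℕ.≡ᵇ b in eq
  ... | true  = ⊥-elim (a≢b (≡ᵇ≡true⇒≡ eq))
  ... | false = refl

  not≡ᵇ⇒≢ : ∀ {a b} → not (a ℕ.≡ᵇ b) ≡ true → a ≢ b
  not≡ᵇ⇒≢ ne a≡b with () ← trans (sym ne) (cong not (≡⇒≡ᵇ≡true a≡b))

  -- The LP objective runs over pairs with `i < j`, but degrees and cuts are sums over ordered
  -- pairs. All comparisons are made with ordered pairs, at the price of this factor 2.
  Σ-edges : ∀ n (f : Fin n → Fin n → ℚ) → (∀ i j → f i j ≡ f j i) → (∀ i → f i i ≡ 0ℚ) →
    Σ n (λ i → Σ n (f i)) ≡ 2ℚ * Σedges n f
  Σ-edges n f f-sym f-diag = begin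
    Σ n (λ i → Σ n (f i))
      ≡⟨ Σ-cong n (λ i → Σ-cong n (split i)) ⟩
    Σ n (λ i → Σ n (λ j → lower i j + lower j i))
      ≡⟨ Σ-cong n (λ i → Σ-+ n (lower i) (λ j → lower j i)) ⟩
    Σ n (λ i → Σ n (lower i) + Σ n (λ j → lower j i))
      ≡⟨ Σ-+ n _ _ ⟩
    L + Σ n (λ i → Σ n (λ j → lower j i))
      ≡⟨ cong (L +_) (Σ-swap n n (λ i j → lower j i)) ⟩
    L + L
      ≡⟨ solve 1 (λ a → a :+ a := (con 1ℚ :+ con 1ℚ) :* a) refl L ⟩
    2ℚ * L ∎
    where
    open ≡-Reasoning
    lower : Fin n → Fin n → ℚ
    lower i j = if toℕ i ℕ.<ᵇ toℕ j then f i j else 0ℚ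
    L = Σ n (λ i → Σ n (lower i))
    split : ∀ i j → f i j ≡ lower i j + lower j i
    split i j with toℕ i ℕ.<ᵇ toℕ j in ij | toℕ j ℕ.<ᵇ toℕ i in ji
    ... | true  | true  = ⊥-elim (ℕ.<-asym (ℕ.<ᵇ⇒< (toℕ i) (toℕ j) (subst T (sym ij) _))
                                            (ℕ.<ᵇ⇒< (toℕ j) (toℕ i) (subst T (sym ji) _)))
    ... | true  | false = sym (ℚ.+-identityʳ (f i j))
    ... | false | true  = trans (f-sym i j) (sym (ℚ.+-identityˡ (f j i)))
    ... | false | false = trans (trans (cong (f i) (sym i≡j)) (f-diag i)) (sym (ℚ.+-identityʳ 0ℚ))
      where
      i≡j : i ≡ j
      i≡j = Fin.toℕ-injective (ℕ.≤-antisym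
        (ℕ.≮⇒≥ (λ lt → subst T ji (ℕ.<⇒<ᵇ lt)))
        (ℕ.≮⇒≥ (λ lt → subst T ij (ℕ.<⇒<ᵇ lt))))


-- Congruences, cosets of the multiples of `a`, and translation invariance of stripes.

module Stripes where

  import Data.Nat
  open import Data.Nat as ℕ using (ℕ; suc; _∸_; _⊓_; NonZero)
  import Data.Nat.Properties as ℕ
  open import Data.Nat.DivMod using (_%_; _mod_; m≡m%n+[m/n]*n; [m+kn]%n≡m%n; m<n⇒m%n≡m; m%n<n; [m+n]%n≡m%n)
  open import Data.Nat.Divisibility using (_∣_; divides)
  open import Data.Nat.GCD using (gcd; gcd[m,n]∣n; gcd-GCD; module Bézout)
  open import Data.Nat.Solver using (module +-*-Solver)
  open import Data.Fin using (Fin; suc; toℕ)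
  import Data.Fin.Properties as Fin
  open import Data.Product using (_×_; _,_; ∃; proj₁; proj₂)
  open import Relation.Nullary using (yes; no)
  open import Relation.Binary.PropositionalEquality
  open Data.Nat using (_+_; _*_; _<_)
  open +-*-Solver using (solve; _:+_; _:*_; _:=_; con)

  -- A multiple of `g` on each side avoids subtraction and makes symmetry a mere exchange.
  record Cong (g a b : ℕ) : Set where
    constructor cong-mod
    field
      k l : ℕ
      eq  : a + k * g ≡ b + l * g

  Cong-reflexive : ∀ {g a b} → a ≡ b → Cong g a b
  Cong-reflexive refl = cong-mod 0 0 refl

  Cong-sym : ∀ {g a b} → Cong g a b → Cong g b a
  Cong-sym (cong-mod k l eq) = cong-mod l k (sym eq)

  Cong-trans : ∀ {g a b c} → Cong g a b → Cong g b c → Cong g a c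
  Cong-trans {g} {a} {b} {c} (cong-mod k l eq) (cong-mod k′ l′ eq′) = cong-mod (k + k′) (l′ + l) (begin
    a + (k + k′) * g      ≡⟨ solve 4 (λ a k k′ g → a :+ (k :+ k′) :* g := (a :+ k :* g) :+ k′ :* g) refl a k k′ g ⟩
    (a + k * g) + k′ * g  ≡⟨ cong (_+ k′ * g) eq ⟩
    (b + l * g) + k′ * g  ≡⟨ solve 4 (λ b k l g → (b :+ l :* g) :+ k :* g := (b :+ k :* g) :+ l :* g) refl b k′ l g ⟩
    (b + k′ * g) + l * g  ≡⟨ cong (_+ l * g) eq′ ⟩
    (c + l′ * g) + l * g  ≡⟨ solve 4 (λ c k l g → (c :+ l :* g) :+ k :* g := c :+ (l :+ k) :* g) refl c l l′ g ⟩
    c + (l′ + l) * g      ∎)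
    where open ≡-Reasoning

  Cong-+ : ∀ {g a b} c → Cong g a b → Cong g (a + c) (b + c)
  Cong-+ {g} {a} {b} c (cong-mod k l eq) = cong-mod k l (begin
    (a + c) + k * g  ≡⟨ solve 3 (λ a c k → (a :+ c) :+ k := (a :+ k) :+ c) refl a c (k * g) ⟩
    (a + k * g) + c  ≡⟨ cong (_+ c) eq ⟩
    (b + l * g) + c  ≡⟨ solve 3 (λ a c k → (a :+ k) :+ c := (a :+ c) :+ k) refl b c (l * g) ⟩
    (b + c) + l * g  ∎)
    where open ≡-Reasoning

  Cong-+-cancel : ∀ {g a b} c → Cong g (a + c) (b + c) → Cong g a b
  Cong-+-cancel {g} {a} {b} c (cong-mod k l eq) = cong-mod k l (ℕ.+-cancelʳ-≡ c _ _ (begin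
    (a + k * g) + c  ≡⟨ solve 3 (λ a c k → (a :+ k) :+ c := (a :+ c) :+ k) refl a c (k * g) ⟩
    (a + c) + k * g  ≡⟨ eq ⟩
    (b + c) + l * g  ≡⟨ solve 3 (λ a c k → (a :+ c) :+ k := (a :+ k) :+ c) refl b c (l * g) ⟩
    (b + l * g) + c  ∎))
    where open ≡-Reasoning

  Cong-+-modulus : ∀ {g} a → Cong g (a + g) a
  Cong-+-modulus {g} a = cong-mod 0 1 (trans (ℕ.+-identityʳ (a + g)) (cong (a +_) (sym (ℕ.*-identityˡ g))))

  Cong-∣ : ∀ {g h a b} → h ∣ g → Cong g a b → Cong h a b
  Cong-∣ {g} {h} {a} {b} (divides m refl) (cong-mod k l eq) = cong-mod (k * m) (l * m) (begin
    a + k * m * h    ≡⟨ cong (a +_) (ℕ.*-assoc k m h) ⟩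
    a + k * (m * h)  ≡⟨ eq ⟩
    b + l * (m * h)  ≡⟨ cong (b +_) (sym (ℕ.*-assoc l m h)) ⟩
    b + l * m * h    ∎)
    where open ≡-Reasoning

  module _ (g : ℕ) .{{_ : NonZero g}} where

    Cong-% : ∀ a → Cong g (a % g) a
    Cong-% a = cong-mod (a ℕ./ g) 0 (trans (sym (m≡m%n+[m/n]*n a g)) (sym (ℕ.+-identityʳ a)))

    Cong⇒%≡ : ∀ {a b} → Cong g a b → a % g ≡ b % g
    Cong⇒%≡ {a} {b} (cong-mod k l eq) = begin
      a % g            ≡⟨ sym ([m+kn]%n≡m%n a k g) ⟩
      (a + k * g) % g  ≡⟨ cong (_% g) eq ⟩
      (b + l * g) % g  ≡⟨ [m+kn]%n≡m%n b l g ⟩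
      b % g            ∎
      where open ≡-Reasoning

    %≡⇒Cong : ∀ {a b} → a % g ≡ b % g → Cong g a b
    %≡⇒Cong {a} {b} eq =
      Cong-trans (Cong-sym (Cong-% a)) (Cong-trans (Cong-reflexive eq) (Cong-% b))

    Cong-<⇒≡ : ∀ {a b} → a < g → b < g → Cong g a b → a ≡ b
    Cong-<⇒≡ a<g b<g a≅b = trans (sym (m<n⇒m%n≡m a<g)) (trans (Cong⇒%≡ a≅b) (m<n⇒m%n≡m b<g))

    -- Bézout, with the sign absorbed by working modulo g.
    gcd-multiple : ∀ a → ∃ λ s → Cong g (s * a) (gcd g a)
    gcd-multiple a with Bézout.identity (gcd-GCD g a)
    ... | Bézout.-+ x y eq = y , cong-mod 0 x (trans (ℕ.+-identityʳ (y * a)) (sym eq))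
    ... | Bézout.+- x y eq = y * ℕ.pred g , cong-mod x (y * a) (begin
      y * ℕ.pred g * a + x * g          ≡⟨ cong (y * ℕ.pred g * a +_) (sym eq) ⟩
      y * ℕ.pred g * a + (d + y * a)    ≡⟨ solve 4 (λ y h a d → y :* h :* a :+ (d :+ y :* a) := d :+ y :* a :* (con 1 :+ h))
                                             refl y (ℕ.pred g) a d ⟩
      d + y * a * suc (ℕ.pred g)        ≡⟨ cong (λ h → d + y * a * h) (ℕ.suc-pred g) ⟩
      d + y * a * g                     ∎)
      where
      open ≡-Reasoning
      d = gcd g a

    -- By Bézout some multiple of `a` is congruent to the gcd, so the multiples of `a` exhaust the
    -- class of `y` modulo the gcd. Since `m * a` is a multiple of `g`, they repeat after `m` steps,
    -- which gives `r < m`.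
    coset-step : ∀ a {m} .{{_ : NonZero m}} → g ≡ m * gcd g a → ∀ {y z} → Cong (gcd g a) y z →
      ∃ λ r → r < m × Cong g (y + r * a) z
    coset-step a {m} g≡md {y} {z} (cong-mod k l eq) = r , m%n<n (q * s) m , Cong-trans reduce (Cong-trans bezout multiple)
      where
      open ≡-Reasoning
      d = gcd g a
      s = proj₁ (gcd-multiple a)
      sa≅d = proj₂ (gcd-multiple a)
      -- This is `k - l` modulo `m`: from `y + k * d ≡ z + l * d`, moving from `y` to `z` takes
      -- `k - l` steps of length `d`, and `m * d` is `g`.
      q = k + l * ℕ.pred m
      r = (q * s) % m
      t = (q * s) ℕ./ m
      a/d = _∣_.quotient (gcd[m,n]∣n g a)
      a≡ : a ≡ a/d * d
      a≡ = _∣_.equality (gcd[m,n]∣n g a)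
      ma≡ : m * a ≡ a/d * g
      ma≡ = begin
        m * a          ≡⟨ cong (m *_) a≡ ⟩
        m * (a/d * d)  ≡⟨ solve 3 (λ m b d → m :* (b :* d) := b :* (m :* d)) refl m a/d d ⟩
        a/d * (m * d)  ≡⟨ cong (a/d *_) (sym g≡md) ⟩
        a/d * g        ∎
      reduce : Cong g (y + r * a) (y + (q * s) * a)
      reduce = cong-mod (t * a/d) 0 (begin
        (y + r * a) + t * a/d * g    ≡⟨ cong (y + r * a +_) (trans (ℕ.*-assoc t a/d g) (cong (t *_) (sym ma≡))) ⟩
        (y + r * a) + t * (m * a)    ≡⟨ solve 5 (λ y r a t m → (y :+ r :* a) :+ t :* (m :* a) := y :+ (r :+ t :* m) :* a)
                                           refl y r a t m ⟩
        y + (r + t * m) * a          ≡⟨ cong (λ x → y + x * a) (sym (m≡m%n+[m/n]*n (q * s) m)) ⟩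
        y + (q * s) * a              ≡⟨ sym (ℕ.+-identityʳ _) ⟩
        y + (q * s) * a + 0 * g      ∎)
      bezout : Cong g (y + (q * s) * a) (y + q * d)
      bezout with cong-mod k′ l′ eq′ ← sa≅d = cong-mod (q * k′) (q * l′) (begin
        (y + (q * s) * a) + q * k′ * g  ≡⟨ solve 6 (λ y q s a k g → (y :+ (q :* s) :* a) :+ q :* k :* g := y :+ q :* (s :* a :+ k :* g))
                                              refl y q s a k′ g ⟩
        y + q * (s * a + k′ * g)        ≡⟨ cong (λ x → y + q * x) eq′ ⟩
        y + q * (d + l′ * g)            ≡⟨ solve 5 (λ y q d l g → y :+ q :* (d :+ l :* g) := (y :+ q :* d) :+ q :* l :* g)
                                              refl y q d l′ g ⟩
        (y + q * d) + q * l′ * g        ∎)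
      multiple : Cong g (y + q * d) z
      multiple = cong-mod 0 l (begin
        y + (k + l * ℕ.pred m) * d + 0   ≡⟨ solve 5 (λ y k l p d → y :+ (k :+ l :* p) :* d :+ con 0 := (y :+ k :* d) :+ l :* (p :* d))
                                               refl y k l (ℕ.pred m) d ⟩
        (y + k * d) + l * (ℕ.pred m * d) ≡⟨ cong (_+ l * (ℕ.pred m * d)) eq ⟩
        (z + l * d) + l * (ℕ.pred m * d) ≡⟨ solve 4 (λ z l d p → (z :+ l :* d) :+ l :* (p :* d) := z :+ l :* ((con 1 :+ p) :* d))
                                               refl z l d (ℕ.pred m) ⟩
        z + l * (suc (ℕ.pred m) * d)     ≡⟨ cong (λ x → z + l * (x * d)) (ℕ.suc-pred m) ⟩
        z + l * (m * d)                  ≡⟨ cong (λ x → z + l * x) (sym g≡md) ⟩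
        z + l * g                        ∎)

  -- The shifted difference is below `2n`, so subtracting `n` once is a full reduction.
  diffMod-% : ∀ n .{{_ : NonZero n}} (i j : Fin n) → diffMod n i j ≡ (toℕ i + n ∸ toℕ j) % n
  diffMod-% n i j with (toℕ i + n ∸ toℕ j) ℕ.<? n
  ... | yes lt = sym (m<n⇒m%n≡m lt)
  ... | no ¬lt = begin
    x ∸ n              ≡⟨ sym (m<n⇒m%n≡m x∸n<n) ⟩
    (x ∸ n) % n        ≡⟨ sym ([m+n]%n≡m%n (x ∸ n) n) ⟩
    ((x ∸ n) + n) % n  ≡⟨ cong (_% n) (ℕ.m∸n+n≡m (ℕ.≮⇒≥ ¬lt)) ⟩
    x % n              ∎
    where
    open ≡-Reasoning
    x = toℕ i + n ∸ toℕ j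
    x∸n<n : x ∸ n < n
    x∸n<n = ℕ.m<n+o⇒m∸n<o x n (ℕ.≤-<-trans (ℕ.m∸n≤m (toℕ i + n) (toℕ j)) (ℕ.+-monoˡ-< n (Fin.toℕ<n i)))

  diffMod-< : ∀ n .{{_ : NonZero n}} (i j : Fin n) → diffMod n i j < n
  diffMod-< n i j = subst (_< n) (sym (diffMod-% n i j)) (m%n<n (toℕ i + n ∸ toℕ j) n)

  diffMod-Cong : ∀ n .{{_ : NonZero n}} (i j : Fin n) → Cong n (diffMod n i j + toℕ j) (toℕ i)
  diffMod-Cong n i j = Cong-trans
    (Cong-+ (toℕ j) (Cong-trans (Cong-reflexive (diffMod-% n i j)) (Cong-% n _)))
    (Cong-trans
      (Cong-reflexive (ℕ.m∸n+n≡m (ℕ.≤-trans (ℕ.<⇒≤ (Fin.toℕ<n j)) (ℕ.m≤n+m n (toℕ i)))))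
      (Cong-+-modulus (toℕ i)))

  diffMod-unique : ∀ n .{{_ : NonZero n}} (i j : Fin n) {r} → r < n → Cong n (r + toℕ j) (toℕ i) → diffMod n i j ≡ r
  diffMod-unique n i j r<n r+j≅i = Cong-<⇒≡ n (diffMod-< n i j) r<n
    (Cong-+-cancel (toℕ j) (Cong-trans (diffMod-Cong n i j) (Cong-sym r+j≅i)))

  toℕ-mod : ∀ n .{{_ : NonZero n}} a → toℕ (a mod n) ≡ a % n
  toℕ-mod n a = Fin.toℕ-fromℕ< (m%n<n a n)

  mod-toℕ : ∀ n .{{_ : NonZero n}} (i : Fin n) → toℕ i mod n ≡ i
  mod-toℕ n i = Fin.toℕ-injective (trans (toℕ-mod n (toℕ i)) (m<n⇒m%n≡m (Fin.toℕ<n i)))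

  Cong⇒mod≡ : ∀ n .{{_ : NonZero n}} {a b} → Cong n a b → a mod n ≡ b mod n
  Cong⇒mod≡ n {a} {b} a≅b =
    Fin.toℕ-injective (trans (toℕ-mod n a) (trans (Cong⇒%≡ n a≅b) (sym (toℕ-mod n b))))

  diffMod-translate : ∀ n .{{_ : NonZero n}} u w s →
    diffMod n ((u + s) mod n) ((w + s) mod n) ≡ diffMod n (u mod n) (w mod n)
  diffMod-translate n u w s = diffMod-unique n _ _ (diffMod-< n (u mod n) (w mod n))
    (Cong-trans (Cong-reflexive (ℕ.+-comm d _))
    (Cong-trans (Cong-+ d (Cong-trans (Cong-reflexive (toℕ-mod n (w + s))) (Cong-% n (w + s))))
    (Cong-trans (Cong-reflexive (solve 3 (λ w s d → (w :+ s) :+ d := w :+ (d :+ s)) refl w s d))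
    (Cong-trans (Cong-+ (d + s) (Cong-sym (Cong-trans (Cong-reflexive (toℕ-mod n w)) (Cong-% n w))))
    (Cong-trans (Cong-reflexive (solve 3 (λ w s d → w :+ (d :+ s) := (d :+ w) :+ s) refl (toℕ (w mod n)) s d))
    (Cong-trans (Cong-+ s (diffMod-Cong n (u mod n) (w mod n)))
    (Cong-trans (Cong-+ s (Cong-trans (Cong-reflexive (toℕ-mod n u)) (Cong-% n u)))
    (Cong-sym (Cong-trans (Cong-reflexive (toℕ-mod n (u + s))) (Cong-% n (u + s)))))))))))
    where d = diffMod n (u mod n) (w mod n)

  stripe-translate : ∀ n .{{_ : NonZero n}} u w s →
    stripe n ((u + s) mod n) ((w + s) mod n) ≡ stripe n (u mod n) (w mod n)
  stripe-translate n u w s = cong₂ _⊓_ (diffMod-translate n u w s) (diffMod-translate n w u s)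

  stripe-sym : ∀ n i j → stripe n i j ≡ stripe n j i
  stripe-sym n i j = ℕ.⊓-comm (diffMod n i j) (diffMod n j i)

-- Walks on the integers, serpentines, and tours obtained from walks.

module Walks where

  open Sums
  open Stripes
  open import Data.Nat as ℕ using (ℕ; zero; suc; NonZero)
  import Data.Nat.Properties as ℕ
  open import Data.Nat.Solver using () renaming (module +-*-Solver to N)
  open import Data.Nat.DivMod using (_mod_)
  open import Data.Bool using (Bool; true; false; not)
  open import Data.Fin using (Fin; zero; suc; toℕ; inject₁; fromℕ; punchOut)
  import Data.Fin.Properties as Fin
  open import Data.Fin.Permutation using (permutation)
  open import Data.List using (List; []; _∷_; _++_; length; lookup)
  open import Data.List.Properties using (length-++)
  open import Data.List.Membership.Propositional using (_∈_)
  open import Data.List.Membership.Propositional.Properties using (∈-++⁺ˡ; ∈-++⁺ʳ)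
  open import Data.List.Relation.Unary.Any using (here; there; index)
  open import Data.List.Relation.Unary.Any.Properties using (lookup-index)
  open import Data.Product using (_×_; _,_; ∃; proj₁; proj₂)
  open import Data.Empty using (⊥-elim)
  open import Relation.Nullary using (yes; no)
  open import Relation.Binary.PropositionalEquality
  open import Data.Rational using (ℚ; 0ℚ; 1ℚ; _+_; _*_; _-_)
  import Data.Rational.Properties as ℚ
  open import Data.Rational.Solver using (module +-*-Solver)
  open +-*-Solver using (solve; _:+_; _:*_; _:-_; _:=_; con)

  -- Concatenation is a constructor, so that serpentines can be defined by recursion on a walk
  -- with their endpoints visible in the type.
  data Walk : ℕ → ℕ → Set where
    [_]  : ∀ u → Walk u u
    _⌢_ : ∀ {u v v′ w} → Walk u v → Walk v′ w → Walk u w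

  edges : ∀ {u w} → Walk u w → ℕ
  edges [ _ ]   = 0
  edges (p ⌢ q) = edges p ℕ.+ suc (edges q)

  data _on_ (y : ℕ) : ∀ {u w} → Walk u w → Set where
    on-[]   : y on [ y ]
    on-left  : ∀ {u v v′ w} {p : Walk u v} {q : Walk v′ w} → y on p → y on (p ⌢ q)
    on-right : ∀ {u v v′ w} {p : Walk u v} {q : Walk v′ w} → y on q → y on (p ⌢ q)

  reverse : ∀ {u w} → Walk u w → Walk w u
  reverse [ u ]   = [ u ]
  reverse (p ⌢ q) = reverse q ⌢ reverse p

  edges-reverse : ∀ {u w} (p : Walk u w) → edges (reverse p) ≡ edges p
  edges-reverse [ _ ]   = refl
  edges-reverse (p ⌢ q) rewrite edges-reverse p | edges-reverse q =
    N.solve 2 (λ a b → b N.:+ (N.con 1 N.:+ a) N.:= a N.:+ (N.con 1 N.:+ b)) refl (edges p) (edges q)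
  on-reverse : ∀ {y u w} {p : Walk u w} → y on p → y on reverse p
  on-reverse on-[]        = on-[]
  on-reverse (on-left y)  = on-right (on-reverse y)
  on-reverse (on-right y) = on-left (on-reverse y)

  -- Vertices stay natural numbers, so that translating a walk is plain addition and one walk can be
  -- read modulo different `g`.
  Covers : ∀ {u w} → ℕ → Walk u w → Set
  Covers g p = ∀ z → ∃ λ y → y on p × Cong g y z

  -- `lo` is the lowest row in use: 0 when a walk is refined from one modulus to the next, 1 when
  -- row 0 must stay free.
  module Serpentine (a lo : ℕ) where

    up : ∀ y k → Walk (y ℕ.+ lo ℕ.* a) (y ℕ.+ (k ℕ.+ lo) ℕ.* a)
    up y zero    = [ _ ]
    up y (suc k) = up y k ⌢ [ y ℕ.+ (suc k ℕ.+ lo) ℕ.* a ]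

    edges-up : ∀ y k → edges (up y k) ≡ k
    edges-up y zero    = refl
    edges-up y (suc k) rewrite edges-up y k = ℕ.+-comm k 1

    on-up : ∀ y {r k} → r ℕ.≤ k → (y ℕ.+ (r ℕ.+ lo) ℕ.* a) on up y k
    on-up y {zero}  {zero}  _ = on-[]
    on-up y {r} {suc k} r≤k with r ℕ.≟ suc k
    ... | yes refl = on-right on-[]
    ... | no  r≢   = on-left (on-up y (ℕ.≤-pred (ℕ.≤∧≢⇒< r≤k r≢)))

    module _ (k : ℕ) where

      -- The rows in which a column starts and ends, for an upward (true) or a downward (false) one.
      start finish : Bool → ℕ
      start true  = lo
      start false = k ℕ.+ lo
      finish d = start (not d)

      column : ∀ d y → Walk (y ℕ.+ start d ℕ.* a) (y ℕ.+ finish d ℕ.* a)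
      column true  y = up y k
      column false y = reverse (up y k)

      -- The direction of the last column. It depends on the parity of the number of vertices of the
      -- walk, so a serpentine may end in its highest or in its lowest row.
      exit : ∀ {u w} → Bool → Walk u w → Bool
      exit d [ _ ]   = d
      exit d (p ⌢ q) = exit (not (exit d p)) q

      serpentine : ∀ {u w} d (p : Walk u w) → Walk (u ℕ.+ start d ℕ.* a) (w ℕ.+ finish (exit d p) ℕ.* a)
      serpentine d [ u ]   = column d u
      serpentine d (p ⌢ q) = serpentine d p ⌢ serpentine (not (exit d p)) q

      edges-column : ∀ d y → edges (column d y) ≡ k
      edges-column true  y = edges-up y k
      edges-column false y = trans (edges-reverse (up y k)) (edges-up y k)

      -- Counted in vertices: these add up under concatenation, and each vertex of `p` becomes a
      -- column of `suc k` of them.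
      edges-serpentine : ∀ {u w} d (p : Walk u w) → suc (edges (serpentine d p)) ≡ suc (edges p) ℕ.* suc k
      edges-serpentine d [ u ]   = cong suc (trans (edges-column d u) (sym (ℕ.+-identityʳ k)))
      edges-serpentine d (p ⌢ q) = trans
        (cong₂ ℕ._+_ (edges-serpentine d p) (edges-serpentine (not (exit d p)) q))
        (sym (ℕ.*-distribʳ-+ (suc k) (suc (edges p)) (suc (edges q))))

      on-column : ∀ d y {r} → r ℕ.≤ k → (y ℕ.+ (r ℕ.+ lo) ℕ.* a) on column d y
      on-column true  y r≤k = on-up y r≤k
      on-column false y r≤k = on-reverse (on-up y r≤k)

      on-serpentine : ∀ {y u w} d {p : Walk u w} {r} → y on p → r ℕ.≤ k →
        (y ℕ.+ (r ℕ.+ lo) ℕ.* a) on serpentine d p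
      on-serpentine d on-[]            r≤k = on-column d _ r≤k
      on-serpentine d (on-left y)      r≤k = on-left (on-serpentine d y r≤k)
      on-serpentine d (on-right y)     r≤k = on-right (on-serpentine _ y r≤k)

  module Cost (e : ℕ → ℕ → ℚ) where

    -- The cost of every step is reduced by λ′: moving along a stripe of cost λ′ is then free.
    cost : ∀ {u w} → ℚ → Walk u w → ℚ
    cost λ′ [ _ ]                   = 0ℚ
    cost λ′ (_⌢_ {v = v} {v′} p q) = cost λ′ p + ((e v v′ - λ′) + cost λ′ q)

    cost-shift : ∀ {u w} λ′ κ (p : Walk u w) → cost λ′ p ≡ cost κ p + (κ - λ′) * ι (edges p)
    cost-shift λ′ κ [ _ ] = sym (trans (ℚ.+-identityˡ _) (ℚ.*-zeroʳ (κ - λ′)))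
    cost-shift λ′ κ (_⌢_ {v = v} {v′} p q) = begin
      cost λ′ p + ((e v v′ - λ′) + cost λ′ q)
        ≡⟨ cong₂ (λ x y → x + ((e v v′ - λ′) + y)) (cost-shift λ′ κ p) (cost-shift λ′ κ q) ⟩
      (P + (κ - λ′) * ι (edges p)) + ((e v v′ - λ′) + (Q + (κ - λ′) * ι (edges q)))
        ≡⟨ solve 7 (λ P Q k l m n e → (P :+ (k :- l) :* m) :+ ((e :- l) :+ (Q :+ (k :- l) :* n)) :=
                     (P :+ ((e :- k) :+ Q)) :+ (k :- l) :* (m :+ (con 1ℚ :+ n)))
                 refl P Q κ λ′ (ι (edges p)) (ι (edges q)) (e v v′) ⟩
      (P + ((e v v′ - κ) + Q)) + (κ - λ′) * (ι (edges p) + ι (suc (edges q)))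
        ≡⟨ cong (λ x → (P + ((e v v′ - κ) + Q)) + (κ - λ′) * x) (sym (ι-+ (edges p) (suc (edges q)))) ⟩
      (P + ((e v v′ - κ) + Q)) + (κ - λ′) * ι (edges p ℕ.+ suc (edges q)) ∎
      where
      open ≡-Reasoning
      P = cost κ p
      Q = cost κ q

    module _ (e-sym : ∀ u w → e u w ≡ e w u) where

      cost-reverse : ∀ {u w} λ′ (p : Walk u w) → cost λ′ (reverse p) ≡ cost λ′ p
      cost-reverse λ′ [ _ ] = refl
      cost-reverse λ′ (_⌢_ {v = v} {v′} p q) rewrite cost-reverse λ′ p | cost-reverse λ′ q | e-sym v′ v =
        solve 3 (λ p q e → q :+ (e :+ p) := p :+ (e :+ q)) refl (cost λ′ p) (cost λ′ q) (e v v′ - λ′)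

      module _ (e-translate : ∀ u w s → e (u ℕ.+ s) (w ℕ.+ s) ≡ e u w) (a lo : ℕ) where

        open Serpentine a lo

        private κ = e 0 a

        e-row : ∀ y r → e (y ℕ.+ r ℕ.* a) (y ℕ.+ suc r ℕ.* a) ≡ κ
        e-row y r = trans
          (cong (e (y ℕ.+ r ℕ.* a)) (N.solve 3
            (λ y r a → y N.:+ (a N.:+ r N.:* a) N.:= a N.:+ (y N.:+ r N.:* a)) refl y r a))
          (e-translate 0 a (y ℕ.+ r ℕ.* a))
        cost-up : ∀ y k → cost κ (up y k) ≡ 0ℚ
        cost-up y zero    = refl
        cost-up y (suc k) rewrite cost-up y k | e-row y (k ℕ.+ lo) =
          solve 1 (λ κ → con 0ℚ :+ ((κ :- κ) :+ con 0ℚ) := con 0ℚ) refl κ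

        -- Steps inside a column are free after subtracting `κ`. A step between columns stays in one
        -- row, because `finish d` is `start (not d)`, and is therefore a translate of a step of
        -- `p`.
        cost-serpentine : ∀ k {u w} d (p : Walk u w) → cost κ (serpentine k d p) ≡ cost κ p
        cost-serpentine k true  [ u ] = cost-up u k
        cost-serpentine k false [ u ] = trans (cost-reverse κ (up u k)) (cost-up u k)
        cost-serpentine k d (_⌢_ {v = v} {v′} p q)
          rewrite cost-serpentine k d p | cost-serpentine k (not (exit k d p)) q
                | e-translate v v′ (start k (not (exit k d p)) ℕ.* a) = refl

  -- Hamiltonian cycles from closed walks

  -- A section `h` is injective; if it missed `i`, punching out `i` would inject `Fin (suc n)` into
  -- `Fin n`.
  surjective⇒leftInverse : ∀ {n} (f h : Fin n → Fin n) → (∀ z → f (h z) ≡ z) → ∀ i → h (f i) ≡ i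
  surjective⇒leftInverse {suc n} f h f∘h i with Fin.any? (λ z → h z Fin.≟ i)
  ... | yes (z , hz≡i) = trans (cong h (trans (cong f (sym hz≡i)) (f∘h z))) hz≡i
  ... | no  i∉h = ⊥-elim (ℕ.1+n≰n (Fin.injective⇒≤ {f = λ z → punchOut (i≢h z)} (λ {x} {y} eq →
      trans (sym (f∘h x)) (trans (cong f (Fin.punchOut-injective (i≢h x) (i≢h y) eq)) (f∘h y)))))
    where
    i≢h : ∀ z → i ≢ h z
    i≢h z eq = i∉h (z , sym eq)

  tail : ∀ {u w} → Walk u w → List ℕ
  tail [ _ ]             = []
  tail (_⌢_ {v′ = v′} p q) = tail p ++ v′ ∷ tail q

  length-tail : ∀ {u w} (p : Walk u w) → length (tail p) ≡ edges p
  length-tail [ _ ]   = refl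
  length-tail (p ⌢ q) = trans (length-++ (tail p)) (cong₂ (λ m n → m ℕ.+ suc n) (length-tail p) (length-tail q))

  on⇒∈ : ∀ {y u w} {p : Walk u w} → y on p → y ∈ u ∷ tail p
  on⇒∈ on-[] = here refl
  on⇒∈ (on-left {p = p} y) with on⇒∈ y
  ... | here eq = here eq
  ... | there y∈ = there (∈-++⁺ˡ y∈)
  on⇒∈ (on-right {p = p} y) = there (∈-++⁺ʳ (tail p) (on⇒∈ y))

  module _ (e : ℕ → ℕ → ℚ) where

    open Cost e

    links : ℕ → List ℕ → ℚ
    links x []       = 0ℚ
    links x (y ∷ ys) = e x y + links y ys

    last : ℕ → List ℕ → ℕ
    last x []       = x
    last x (y ∷ ys) = last y ys

    links-++ : ∀ x xs y ys → links x (xs ++ y ∷ ys) ≡ links x xs + (e (last x xs) y + links y ys)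
    links-++ x []        y ys = sym (ℚ.+-identityˡ _)
    links-++ x (x′ ∷ xs) y ys = trans (cong (e x x′ +_) (links-++ x′ xs y ys)) (sym (ℚ.+-assoc (e x x′) _ _))

    last-++ : ∀ x xs y ys → last x (xs ++ y ∷ ys) ≡ last y ys
    last-++ x []        y ys = refl
    last-++ x (x′ ∷ xs) y ys = last-++ x′ xs y ys

    last-tail : ∀ {u w} (p : Walk u w) → last u (tail p) ≡ w
    last-tail [ _ ]   = refl
    last-tail {u} (_⌢_ {v′ = v′} p q) = trans (last-++ u (tail p) v′ (tail q)) (last-tail q)

    links-tail : ∀ {u w} (p : Walk u w) → links u (tail p) ≡ cost 0ℚ p
    links-tail [ _ ]   = refl
    links-tail {u} (_⌢_ {v = v} {v′} p q) = trans (links-++ u (tail p) v′ (tail q))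
      (cong₂ _+_ (links-tail p) (cong₂ _+_
        (trans (cong (λ x → e x v′) (last-tail p)) (sym (ℚ.+-identityʳ (e v v′))))
        (links-tail q)))

    Σ-links : ∀ x xs → Σ (length xs) (λ k → e (lookup (x ∷ xs) (inject₁ k)) (lookup xs k)) ≡ links x xs
    Σ-links x []       = refl
    Σ-links x (y ∷ ys) = cong (e x y +_) (Σ-links y ys)

    lookup-last : ∀ x xs → lookup (x ∷ xs) (fromℕ (length xs)) ≡ last x xs
    lookup-last x []       = refl
    lookup-last x (y ∷ ys) = lookup-last y ys

    Σ-cyclic : ∀ x xs → Σ (suc (length xs)) (λ k → e (lookup (x ∷ xs) k) (lookup (x ∷ xs) (next k))) ≡
      links x xs + e (last x xs) x
    Σ-cyclic x xs = trans (Σ-next (length xs) (λ j k → e (lookup (x ∷ xs) j) (lookup (x ∷ xs) k)))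
      (cong₂ _+_ (Σ-links x xs) (cong (λ y → e y x) (lookup-last x xs)))

  circulantCost : ∀ n .{{_ : NonZero n}} → (Fin (n ℕ./ 2) → ℚ) → ℕ → ℕ → ℚ
  circulantCost n c u w = edgeCost n c (u mod n) (w mod n)

  walk⇒tour : ∀ n .{{_ : NonZero n}} c {u w} (p : Walk u w) → suc (edges p) ≡ n → Covers n p →
    ∃ λ σ → tourCost n c σ ≡ Cost.cost (circulantCost n c) 0ℚ p + circulantCost n c w u
  walk⇒tour n c {u} {w} p size cover = go n c (trans (cong suc (length-tail p)) size) cover
    where
    xs = tail p
    -- `n` and what depends on it are abstracted again, so that matching on `refl` turns positions
    -- in the vertex list into elements of `Fin n`. The walk hits all `n` residues at `n` positions,
    -- hence each of them once.
    go : ∀ n .{{_ : NonZero n}} c → suc (length xs) ≡ n → Covers n p →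
      ∃ λ σ → tourCost n c σ ≡ Cost.cost (circulantCost n c) 0ℚ p + circulantCost n c w u
    go n c refl cover = permutation f h f∘h (surjective⇒leftInverse f h f∘h) ,
      trans (Σ-cyclic (circulantCost n c) u xs)
        (cong₂ _+_ (links-tail (circulantCost n c) p)
          (cong (λ v → circulantCost n c v u) (last-tail (circulantCost n c) p)))
      where
      f h : Fin n → Fin n
      f k = lookup (u ∷ xs) k mod n
      hit : ∀ z → proj₁ (cover (toℕ z)) ∈ u ∷ xs
      hit z = on⇒∈ (proj₁ (proj₂ (cover (toℕ z))))
      h z = index (hit z)
      f∘h : ∀ z → f (h z) ≡ z
      f∘h z = trans (cong (_mod n) (sym (lookup-index (hit z))))
        (trans (Cong⇒mod≡ n (proj₂ (proj₂ (cover (toℕ z))))) (mod-toℕ n z))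

-- The upper bound: tours of cost at most twice the LP.

module Upper where

  open Sums
  open Stripes
  open Walks
  open import Data.Nat as ℕ using (ℕ; zero; suc; NonZero; _∸_)
  import Data.Nat.Properties as ℕ
  open import Data.Nat.Solver using () renaming (module +-*-Solver to N)
  open import Data.Nat.DivMod using (_%_; _mod_; m<n⇒m%n≡m)
  open import Data.Nat.Divisibility using (_∣_; divides; _∣?_; ∣⇒≤; ∣-trans; ∣-refl; ∣n∣m%n⇒∣m; ∣1⇒≡1)
  open import Data.Nat.GCD using (gcd; gcd[m,n]∣m; gcd[m,n]∣n)
  open import Data.Nat.Induction using (<-wellFounded)
  open import Induction.WellFounded using (Acc; acc)
  open import Data.Bool using (Bool; true; false; not; _∧_; if_then_else_)
  open import Data.Bool.Properties using (∧-conicalˡ; ∧-conicalʳ)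
  open import Data.Fin using (Fin; zero; suc; toℕ; fromℕ<)
  import Data.Fin.Properties as Fin
  open import Data.Product using (_×_; _,_; ∃; proj₁; proj₂)
  open import Data.Sum using (inj₁; inj₂)
  open import Data.Empty using (⊥-elim)
  open import Relation.Nullary using (Dec; yes; no; ¬_)
  open import Relation.Nullary.Decidable using (¬?)
  open import Relation.Unary using (Decidable)
  open import Relation.Binary.PropositionalEquality
  open import Data.Rational using (ℚ; 0ℚ; 1ℚ; _+_; _*_; _-_; _≤_)
  import Data.Rational.Properties as ℚ
  open import Data.Rational.Solver using (module +-*-Solver)
  open +-*-Solver using (solve; _:+_; _:*_; _:-_; _:=_; con)

  argmin : ∀ n {P : Fin n → Set} → Decidable P → (f : Fin n → ℚ) → ∃ P →
    ∃ λ i → P i × (∀ j → P j → f i ≤ f j)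
  argmin (suc n) {P} P? f (i , Pi) with Fin.any? (λ j → P? (suc j))
  ... | no none = zero , P₀ i Pi , λ { zero _ → ℚ.≤-refl ; (suc j) Pj → ⊥-elim (none (j , Pj)) }
    where
    P₀ : ∀ i → P i → P zero
    P₀ zero    Pi = Pi
    P₀ (suc i) Pi = ⊥-elim (none (i , Pi))
  ... | yes some with argmin n (λ j → P? (suc j)) (λ j → f (suc j)) some
  ...   | j , Pj , min with P? zero
  ...     | no ¬P₀ = suc j , Pj , λ { zero P₀ → ⊥-elim (¬P₀ P₀) ; (suc k) Pk → min k Pk }
  ...     | yes P₀ with ℚ.≤-total (f zero) (f (suc j))
  ...       | inj₁ le = zero , P₀ , λ { zero _ → ℚ.≤-refl ; (suc k) Pk → ℚ.≤-trans le (min k Pk) }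
  ...       | inj₂ ge = suc j , Pj , λ { zero _ → ge ; (suc k) Pk → min k Pk }

  stripeCost-nonneg : ∀ d (c : Fin d → ℚ) → (∀ k → 0ℚ ≤ c k) → ∀ k → 0ℚ ≤ stripeCost d c k
  stripeCost-nonneg zero    c 0≤c k             = ℚ.≤-refl
  stripeCost-nonneg (suc d) c 0≤c zero          = ℚ.≤-refl
  stripeCost-nonneg (suc d) c 0≤c (suc zero)    = 0≤c zero
  stripeCost-nonneg (suc d) c 0≤c (suc (suc k)) = stripeCost-nonneg d (λ i → c (suc i)) (λ i → 0≤c (suc i)) (suc k)

  -- The quotient is the number of rows of the cylinder. It is at least 2 when `g` does not divide
  -- `a`; a column through all rows has `suc k` steps, and one that spares a row has `k`.
  record GcdQuotient (g a : ℕ) : Set where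
    field
      k        : ℕ
      nonZero  : NonZero (gcd g a)
      quotient : g ≡ suc (suc k) ℕ.* gcd g a
      smaller  : gcd g a ℕ.< g

  gcd-quotient : ∀ g .{{_ : NonZero g}} a → ¬ g ∣ a → GcdQuotient g a
  gcd-quotient g a g∤a with gcd[m,n]∣m g a
  ... | divides zero          eq = ⊥-elim (ℕ.≢-nonZero⁻¹ g eq)
  ... | divides (suc zero)    eq =
    ⊥-elim (g∤a (subst (_∣ a) (sym (trans eq (ℕ.+-identityʳ _))) (gcd[m,n]∣n g a)))
  ... | divides (suc (suc k)) eq = record
    { k        = k
    ; nonZero  = ℕ.≢-nonZero d≢0
    ; quotient = eq
    ; smaller  = subst (gcd g a ℕ.<_) (sym eq)
        (ℕ.m<m+n (gcd g a) (ℕ.<-≤-trans (ℕ.n≢0⇒n>0 d≢0) (ℕ.m≤m+n (gcd g a) _)))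
    }
    where
    d≢0 : gcd g a ≢ 0
    d≢0 d≡0 = ℕ.≢-nonZero⁻¹ g (trans eq (trans (cong (suc (suc k) ℕ.*_) d≡0) (ℕ.*-zeroʳ (suc (suc k)))))

  ∣-difference⇒Cong : ∀ {g n i j} → g ∣ n → i ℕ.≤ n → g ∣ j ℕ.+ (n ∸ i) → Cong g j i
  ∣-difference⇒Cong {g} {n} {i} {j} (divides m n≡mg) i≤n (divides q eq) = cong-mod m q (begin
    j ℕ.+ m ℕ.* g              ≡⟨ cong (j ℕ.+_) (sym n≡mg) ⟩
    j ℕ.+ n                    ≡⟨ cong (j ℕ.+_) (sym (ℕ.m∸n+n≡m i≤n)) ⟩
    j ℕ.+ ((n ∸ i) ℕ.+ i)      ≡⟨ sym (ℕ.+-assoc j _ _) ⟩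
    (j ℕ.+ (n ∸ i)) ℕ.+ i      ≡⟨ cong (ℕ._+ i) eq ⟩
    q ℕ.* g ℕ.+ i              ≡⟨ ℕ.+-comm _ i ⟩
    i ℕ.+ q ℕ.* g              ∎)
    where open ≡-Reasoning

  module UpperBound (n : ℕ) .{{_ : NonZero n}} (c : Fin (n ℕ./ 2) → ℚ) (0≤c : ∀ k → 0ℚ ≤ c k)
    (x : LPPoint n) (feasible : SubtourFeasible n x) where

    open SubtourFeasible feasible

    e : ℕ → ℕ → ℚ
    e = circulantCost n c

    κ : ℕ → ℚ
    κ = e 0

    open Cost e

    e-sym : ∀ u w → e u w ≡ e w u
    e-sym u w = cong (stripeCost (n ℕ./ 2) c) (stripe-sym n (u mod n) (w mod n))

    e-translate : ∀ u w s → e (u ℕ.+ s) (w ℕ.+ s) ≡ e u w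
    e-translate u w s = cong (stripeCost (n ℕ./ 2) c) (stripe-translate n u w s)

    e-Cong : ∀ {u u′ w w′} → Cong n u u′ → Cong n w w′ → e u w ≡ e u′ w′
    e-Cong uu′ ww′ = cong₂ (edgeCost n c) (Cong⇒mod≡ n uu′) (Cong⇒mod≡ n ww′)

    edgeCost-κ : ∀ i j → edgeCost n c i j ≡ κ (toℕ j ℕ.+ (n ∸ toℕ i))
    edgeCost-κ i j = begin
      edgeCost n c i j                              ≡⟨ sym (cong₂ (edgeCost n c) (mod-toℕ n i) (mod-toℕ n j)) ⟩
      e (toℕ i) (toℕ j)                             ≡⟨ sym (e-translate (toℕ i) (toℕ j) (n ∸ toℕ i)) ⟩
      e (toℕ i ℕ.+ (n ∸ toℕ i)) (toℕ j ℕ.+ (n ∸ toℕ i))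
        ≡⟨ e-Cong (Cong-trans (Cong-reflexive (ℕ.m+[n∸m]≡n (ℕ.<⇒≤ (Fin.toℕ<n i)))) (Cong-+-modulus 0))
             (Cong-reflexive refl) ⟩
      κ (toℕ j ℕ.+ (n ∸ toℕ i))                     ∎
      where open ≡-Reasoning

    -- The values that can be subtracted from all edges between residue classes modulo `g` while
    -- keeping them nonnegative. A bound for `g` is also one for each divisor of `g`, which has
    -- fewer stripes to compare with.
    LowerBound : ℕ → ℚ → Set
    LowerBound g λ′ = ∀ b → ¬ g ∣ b → λ′ ≤ κ b

    cheapest : ∀ g → g ∣ n → 1 ℕ.< g → ∃ λ a → ¬ g ∣ a × LowerBound g (κ a)
    cheapest g g∣n 1<g
      with argmin n (λ i → ¬? (g ∣? toℕ i)) (λ i → κ (toℕ i)) (fromℕ< 1<n , g∤1)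
      where
      1<n = ℕ.<-≤-trans 1<g (∣⇒≤ g∣n)
      g∤1 : ¬ g ∣ toℕ (fromℕ< 1<n)
      g∤1 g∣1 = ℕ.<⇒≢ 1<g (sym (∣1⇒≡1 (subst (g ∣_) (Fin.toℕ-fromℕ< 1<n) g∣1)))
    ... | a , g∤a , min = toℕ a , g∤a , λ b g∤b → subst (κ (toℕ a) ≤_)
      (e-Cong (Cong-reflexive refl) (Cong-trans (Cong-reflexive (toℕ-mod n b)) (Cong-% n b)))
      (min (b mod n) (λ g∣ → g∤b (∣n∣m%n⇒∣m g∣n (subst (g ∣_) (toℕ-mod n b) g∣))))

    crosses : ∀ g .{{_ : NonZero g}} → Fin n → Fin n → Bool
    crosses g i j = not (toℕ i % g ℕ.≡ᵇ toℕ j % g)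

    crosses-bound : ∀ g .{{_ : NonZero g}} {λ′} → g ∣ n → LowerBound g λ′ → ∀ i j →
      crosses g i j ≡ true → λ′ ≤ edgeCost n c i j
    crosses-bound g {λ′} g∣n bound i j cr with toℕ i % g ℕ.≟ toℕ j % g
    ... | yes i≡j = ⊥-elim (not≡ᵇ⇒≢ cr i≡j)
    ... | no i≢j = subst (λ′ ≤_) (sym (edgeCost-κ i j)) (bound _ (λ g∣ →
      i≢j (sym (Cong⇒%≡ g (∣-difference⇒Cong g∣n (ℕ.<⇒≤ (Fin.toℕ<n i)) g∣)))))

    ΣΣ : (Fin n → Fin n → ℚ) → ℚ
    ΣΣ f = Σ n (λ i → Σ n (f i))

    ΣΣ-mono : ∀ {f f′} → (∀ i j → f i j ≤ f′ i j) → ΣΣ f ≤ ΣΣ f′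
    ΣΣ-mono le = Σ-mono n (λ i → Σ-mono n (le i))

    ΣΣ-cong : ∀ {f f′} → (∀ i j → f i j ≡ f′ i j) → ΣΣ f ≡ ΣΣ f′
    ΣΣ-cong eq = Σ-cong n (λ i → Σ-cong n (eq i))

    ΣΣ-+ : ∀ f f′ → ΣΣ (λ i j → f i j + f′ i j) ≡ ΣΣ f + ΣΣ f′
    ΣΣ-+ f f′ = trans (Σ-cong n (λ i → Σ-+ n (f i) (f′ i))) (Σ-+ n _ _)

    ΣΣ-*ˡ : ∀ q f → ΣΣ (λ i j → q * f i j) ≡ q * ΣΣ f
    ΣΣ-*ˡ q f = trans (Σ-cong n (λ i → Σ-*ˡ n q (f i))) (Σ-*ˡ n q _)

    restrict : ∀ g .{{_ : NonZero g}} → (Fin n → Fin n → ℚ) → Fin n → Fin n → ℚ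
    restrict g f i j = if crosses g i j then f i j else 0ℚ

    reduced : ℚ → Fin n → Fin n → ℚ
    reduced λ′ i j = x i j * (edgeCost n c i j - λ′)

    -- The share of the LP cost that pays for a spanning walk modulo `g`.
    W : ∀ g .{{_ : NonZero g}} → ℚ → ℚ
    W g λ′ = ΣΣ (restrict g (reduced λ′))

    restrict-reduced-nonneg : ∀ g .{{_ : NonZero g}} {λ′} → g ∣ n → LowerBound g λ′ → ∀ i j →
      0ℚ ≤ restrict g (reduced λ′) i j
    restrict-reduced-nonneg g g∣n bound i j =
      if-nonneg (crosses g i j) (λ cr → *-nonneg (lower i j) (p≤q⇒0≤q-p (crosses-bound g g∣n bound i j cr)))

    crosses-∣ : ∀ g h .{{_ : NonZero g}} .{{_ : NonZero h}} → h ∣ g → ∀ i j →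
      crosses h i j ≡ true → crosses g i j ≡ true
    crosses-∣ g h h∣g i j cr = cong not (≢⇒≡ᵇ≡false (λ eq →
      not≡ᵇ⇒≢ cr (Cong⇒%≡ h (Cong-∣ h∣g (%≡⇒Cong g eq)))))

    -- Passing to the coarser modulus `h` drops edges inside the merged classes, and the bound makes
    -- each dropped term nonnegative.
    W-mono : ∀ g h .{{_ : NonZero g}} .{{_ : NonZero h}} {λ′} → g ∣ n → h ∣ g → LowerBound g λ′ →
      W h λ′ ≤ W g λ′
    W-mono g h {λ′} g∣n h∣g bound = ΣΣ-mono (λ i j → if-mono (crosses h i j) (crosses g i j)
      (crosses-∣ g h h∣g i j) (restrict-reduced-nonneg g g∣n bound i j))

    W-shift : ∀ g .{{_ : NonZero g}} λ′ μ → W g λ′ ≡ W g μ + (μ - λ′) * ΣΣ (restrict g x)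
    W-shift g λ′ μ = begin
      W g λ′                                                ≡⟨ ΣΣ-cong term ⟩
      ΣΣ (λ i j → restrict g (reduced μ) i j + (μ - λ′) * restrict g x i j)
        ≡⟨ ΣΣ-+ (restrict g (reduced μ)) (λ i j → (μ - λ′) * restrict g x i j) ⟩
      W g μ + ΣΣ (λ i j → (μ - λ′) * restrict g x i j)      ≡⟨ cong (W g μ +_) (ΣΣ-*ˡ (μ - λ′) (restrict g x)) ⟩
      W g μ + (μ - λ′) * ΣΣ (restrict g x)                  ∎
      where
      open ≡-Reasoning
      term : ∀ i j → restrict g (reduced λ′) i j ≡ restrict g (reduced μ) i j + (μ - λ′) * restrict g x i j
      term i j = if-shift (crosses g i j) (x i j) (edgeCost n c i j) λ′ μ

    -- Summing the subtour constraints of the residue classes counts every crossing edge twice.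
    crossing-weight : ∀ g .{{_ : NonZero g}} → 1 ℕ.< g → g ℕ.≤ n → ι g * 2ℚ ≤ ΣΣ (restrict g x)
    crossing-weight g 1<g g≤n = begin
      ι g * 2ℚ                    ≡⟨ sym (Σ-const g 2ℚ) ⟩
      Σ g (λ _ → 2ℚ)              ≤⟨ Σ-mono g class-cut ⟩
      Σ g (λ r → cut n x (S r))   ≡⟨ Σ-swap g n _ ⟩
      Σ n (λ i → Σ g (λ r → Σ n (λ j → term r i j)))  ≡⟨ Σ-cong n (λ i → Σ-swap g n (λ r j → term r i j)) ⟩
      Σ n (λ i → Σ n (λ j → Σ g (λ r → term r i j)))  ≤⟨ ΣΣ-mono inner ⟩
      ΣΣ (restrict g x)           ∎
      where
      open ℚ.≤-Reasoning
      S : Fin g → Fin n → Bool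
      S r i = toℕ i % g ℕ.≡ᵇ toℕ r
      term : Fin g → Fin n → Fin n → ℚ
      term r i j = if S r i ∧ not (S r j) then x i j else 0ℚ
      representative : ∀ k → k ℕ.< g → ∃ λ i → toℕ i % g ≡ k
      representative k k<g = fromℕ< k<n , trans (cong (_% g) (Fin.toℕ-fromℕ< k<n)) (m<n⇒m%n≡m k<g)
        where k<n = ℕ.<-≤-trans k<g g≤n
      member : ∀ r → ∃ λ i → S r i ≡ true
      member r with representative (toℕ r) (Fin.toℕ<n r)
      ... | i , eq = i , ≡⇒≡ᵇ≡true eq
      -- Class 0 misses the vertex 1 and every other class misses 0; `1 < g` makes these two
      -- residues distinct.
      nonmember : ∀ r → ∃ λ i → S r i ≡ false
      nonmember r with toℕ r
      ... | zero  with representative 1 1<g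
      ...   | i , eq = i , cong (ℕ._≡ᵇ 0) eq
      nonmember r | suc k with representative 0 (ℕ.<-trans ℕ.z<s 1<g)
      ...   | i , eq = i , cong (ℕ._≡ᵇ suc k) eq
      class-cut : ∀ r → 2ℚ ≤ cut n x (S r)
      class-cut r = subtour (S r) (member r) (nonmember r)
      -- Only the class of `i` can contribute, and only if `j` lies outside it.
      inner : ∀ i j → Σ g (λ r → term r i j) ≤ restrict g x i j
      inner i j = Σ-≤-if g (λ r → S r i ∧ not (S r j)) (crosses g i j) (lower i j)
        (λ r both → cong not (≢⇒≡ᵇ≡false (λ i≡j → true≢false
          (trans (sym (∧-conicalʳ _ _ both)) (cong not (≡⇒≡ᵇ≡true (trans (sym i≡j) (is r both))))))))
        (λ r s rᵢ sᵢ → Fin.toℕ-injective (trans (sym (is r rᵢ)) (is s sᵢ)))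
        where
        true≢false : true ≢ false
        true≢false ()
        is : ∀ r → (S r i ∧ not (S r j)) ≡ true → toℕ i % g ≡ toℕ r
        is r both = ≡ᵇ≡true⇒≡ (∧-conicalˡ _ _ both)

    record SpanningWalk (g : ℕ) .{{_ : NonZero g}} : Set where
      field
        {from to} : ℕ
        walk   : Walk from to
        size   : suc (edges walk) ≡ g
        covers : Covers g walk
        -- The factor 2 is there because W counts every edge in both directions.
        cheap  : ∀ λ′ → LowerBound g λ′ → 2ℚ * cost λ′ walk ≤ W g λ′

    -- Here the subtour constraints enter. The left side grows by `2 (μ - λ′)` for each of the
    -- `g - 1` steps, the right side by `μ - λ′` times a crossing weight of at least `2g`.
    cheap-shift : ∀ g .{{_ : NonZero g}} {u w λ′ μ} (q : Walk u w) → λ′ ≤ μ → suc (edges q) ≡ g →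
      1 ℕ.< g → g ℕ.≤ n → 2ℚ * cost μ q ≤ W g μ → 2ℚ * cost λ′ q ≤ W g λ′
    cheap-shift g {λ′ = λ′} {μ} q λ′≤μ size 1<g g≤n cheap = begin
      2ℚ * cost λ′ q
        ≡⟨ cong (2ℚ *_) (cost-shift λ′ μ q) ⟩
      2ℚ * (cost μ q + (μ - λ′) * ι (edges q))
        ≡⟨ solve 4 (λ t c k m → t :* (c :+ k :* m) := t :* c :+ k :* (m :* t)) refl 2ℚ (cost μ q) (μ - λ′) (ι (edges q)) ⟩
      2ℚ * cost μ q + (μ - λ′) * (ι (edges q) * 2ℚ)
        ≤⟨ ℚ.+-mono-≤ cheap (*-mono-≤ˡ (p≤q⇒0≤q-p λ′≤μ) weight) ⟩
      W g μ + (μ - λ′) * ΣΣ (restrict g x)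
        ≡⟨ sym (W-shift g λ′ μ) ⟩
      W g λ′ ∎
      where
      open ℚ.≤-Reasoning
      weight : ι (edges q) * 2ℚ ≤ ΣΣ (restrict g x)
      weight = ℚ.≤-trans
        (ℚ.*-monoʳ-≤-nonNeg 2ℚ (ι-mono (subst (edges q ℕ.≤_) size (ℕ.n≤1+n (edges q)))))
        (crossing-weight g 1<g g≤n)

    trivial-walk : ∀ g .{{_ : NonZero g}} → g ∣ n → ¬ 1 ℕ.< g → SpanningWalk g
    trivial-walk g g∣n 1≮g = record
      { walk   = [ 0 ]
      ; size   = sym g≡1
      ; covers = λ z → 0 , on-[] , subst (λ g → Cong g 0 z) (sym g≡1)
          (cong-mod z 0 (trans (ℕ.*-identityʳ z) (sym (ℕ.+-identityʳ z))))
      ; cheap  = λ λ′ bound → ℚ.≤-trans (ℚ.≤-reflexive (ℚ.*-zeroʳ 2ℚ))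
          (Σ-nonneg n (λ i → Σ-nonneg n (restrict-reduced-nonneg g g∣n bound i)))
      }
      where
      g≡1 : g ≡ 1
      g≡1 = ℕ.≤-antisym (ℕ.≮⇒≥ 1≮g) (ℕ.>-nonZero⁻¹ g)

    module Extend (g : ℕ) .{{_ : NonZero g}} (g∣n : g ∣ n) (1<g : 1 ℕ.< g) (a : ℕ) (g∤a : ¬ g ∣ a)
      (min : LowerBound g (κ a)) (k : ℕ) .{{_ : NonZero (gcd g a)}} (g≡ : g ≡ suc (suc k) ℕ.* gcd g a)
      (sw : SpanningWalk (gcd g a)) where

      open Serpentine a 0
      open SpanningWalk sw using (from; to) renaming (walk to p)

      d : ℕ
      d = gcd g a

      d∣g : d ∣ g
      d∣g = gcd[m,n]∣m g a

      q : Walk (from ℕ.+ 0 ℕ.* a) (to ℕ.+ finish (suc k) (exit (suc k) true p) ℕ.* a)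
      -- A walk need not close up, so all `suc (suc k)` rows are swept and none is kept for a way
      -- back.
      q = serpentine (suc k) true p

      covers : Covers g q
      covers z = lift (proj₁ (proj₂ on-p)) (coset-step g a g≡ (proj₂ (proj₂ on-p)))
        where
        on-p = SpanningWalk.covers sw z
        lift : ∀ {y} → y on p → (∃ λ r → r ℕ.< suc (suc k) × Cong g (y ℕ.+ r ℕ.* a) z) →
          ∃ λ y′ → y′ on q × Cong g y′ z
        lift {y} y∈p (r , r<m , y≅z) = _ , on-serpentine (suc k) true y∈p (ℕ.≤-pred r<m) ,
          subst (λ r → Cong g (y ℕ.+ r ℕ.* a) z) (sym (ℕ.+-identityʳ r)) y≅z

      size : suc (edges q) ≡ g
      size = trans (edges-serpentine (suc k) true p)
        (trans (cong (ℕ._* suc (suc k)) (SpanningWalk.size sw)) (trans (ℕ.*-comm d (suc (suc k))) (sym g≡)))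

      -- At this level the refined walk costs as much as `p`, so the bound for `d` is inherited and
      -- only `W` has to be compared.
      cheap-q : 2ℚ * cost (κ a) q ≤ W g (κ a)
      cheap-q = subst (λ y → 2ℚ * y ≤ W g (κ a)) (sym (cost-serpentine e-sym e-translate a 0 (suc k) true p)) (ℚ.≤-trans
        (SpanningWalk.cheap sw (κ a) (λ b d∤b → min b (λ g∣b → d∤b (∣-trans d∣g g∣b))))
        (W-mono g d g∣n d∣g min))

      extended : SpanningWalk g
      extended = record
        { walk   = q
        ; size   = size
        ; covers = covers
        -- Any admissible `λ′` is at most `κ a`, since `a` itself is not divisible by `g`.
        ; cheap  = λ λ′ bound → cheap-shift g q (bound a g∤a) size 1<g (∣⇒≤ g∣n) cheap-q
        }

    spanning-walk : ∀ g .{{_ : NonZero g}} → Acc ℕ._<_ g → g ∣ n → SpanningWalk g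
    spanning-walk g (acc rec) g∣n with 1 ℕ.<? g
    ... | no  1≮g = trivial-walk g g∣n 1≮g
    ... | yes 1<g with cheapest g g∣n 1<g
    ...   | a , g∤a , min with gcd-quotient g a g∤a
    ...     | record { k = k ; nonZero = nz ; quotient = g≡ ; smaller = d<g } =
      Extend.extended g g∣n 1<g a g∤a min k {{nz}} g≡
        (spanning-walk (gcd g a) {{nz}} (rec d<g) (∣-trans (gcd[m,n]∣m g a) g∣n))

    -- The degree constraints fix the total weight at `2n` over ordered pairs, so subtracting `κ a`
    -- from every edge lowers the cost by a known amount. All remaining costs are nonnegative, and
    -- those inside residue classes modulo `d` are discarded.
    total-cost : ∀ a d .{{_ : NonZero d}} → d ∣ n → LowerBound n (κ a) →
      W d (κ a) + κ a * (ι n * 2ℚ) ≤ 2ℚ * lpCost n c x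
    total-cost a d d∣n min = begin
      W d (κ a) + κ a * (ι n * 2ℚ)
        ≡⟨ cong (λ y → W d (κ a) + κ a * y) (sym total-weight) ⟩
      W d (κ a) + κ a * ΣΣ x
        ≡⟨ cong (W d (κ a) +_) (sym (ΣΣ-*ˡ (κ a) x)) ⟩
      W d (κ a) + ΣΣ (λ i j → κ a * x i j)
        ≡⟨ sym (ΣΣ-+ (restrict d (reduced (κ a))) (λ i j → κ a * x i j)) ⟩
      ΣΣ (λ i j → restrict d (reduced (κ a)) i j + κ a * x i j)
        ≤⟨ ΣΣ-mono term ⟩
      ΣΣ (λ i j → edgeCost n c i j * x i j)
        ≡⟨ Σ-edges n (λ i j → edgeCost n c i j * x i j)
             (λ i j → cong₂ _*_ (cong (stripeCost (n ℕ./ 2) c) (stripe-sym n i j)) (symmetric i j))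
             (λ i → trans (cong (edgeCost n c i i *_) (diagonal i)) (ℚ.*-zeroʳ (edgeCost n c i i))) ⟩
      2ℚ * lpCost n c x ∎
      where
      open ℚ.≤-Reasoning
      total-weight : ΣΣ x ≡ ι n * 2ℚ
      total-weight = trans (Σ-cong n degree) (Σ-const n 2ℚ)
      -- The bound says nothing about the diagonal, where the edge cost may lie below `κ a`; there
      -- `x` vanishes.
      reduced-nonneg : ∀ i j → 0ℚ ≤ reduced (κ a) i j
      reduced-nonneg i j = nonneg (i Fin.≟ j)
        where
        nonneg : Dec (i ≡ j) → 0ℚ ≤ reduced (κ a) i j
        nonneg (yes i≡j) = ℚ.≤-reflexive (sym (trans
          (cong (_* (edgeCost n c i j - κ a)) (trans (cong (x i) (sym i≡j)) (diagonal i))) (ℚ.*-zeroˡ (edgeCost n c i j - κ a))))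
        nonneg (no  i≢j) = *-nonneg (lower i j) (p≤q⇒0≤q-p (crosses-bound n ∣-refl min i j crosses-n))
          where
          crosses-n : crosses n i j ≡ true
          crosses-n = cong not (≢⇒≡ᵇ≡false (λ eq → i≢j (Fin.toℕ-injective
            (trans (sym (m<n⇒m%n≡m (Fin.toℕ<n i))) (trans eq (m<n⇒m%n≡m (Fin.toℕ<n j)))))))
      regroup : ∀ i j → reduced (κ a) i j + κ a * x i j ≡ edgeCost n c i j * x i j
      regroup i j = solve 3 (λ x e k → x :* (e :- k) :+ k :* x := e :* x) refl (x i j) (edgeCost n c i j) (κ a)
      term : ∀ i j → restrict d (reduced (κ a)) i j + κ a * x i j ≤ edgeCost n c i j * x i j
      term i j = ℚ.≤-trans (ℚ.+-monoˡ-≤ (κ a * x i j) (if-≤ (crosses d i j) (reduced-nonneg i j)))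
        (ℚ.≤-reflexive (regroup i j))

    -- Row 0 of the cylinder is reserved for the way back.
    cylinder-tour : ∀ a → LowerBound n (κ a) → GcdQuotient n a → ∃ λ σ → tourCost n c σ ≤ 2ℚ * lpCost n c x
    cylinder-tour a min record { k = k ; nonZero = nz ; quotient = n≡ } = proj₁ tour , (begin
      tourCost n c (proj₁ tour)
        ≡⟨ proj₂ tour ⟩
      cost 0ℚ t + e from (from ℕ.+ 1 ℕ.* a)
        ≡⟨ cong₂ _+_ (cost-shift 0ℚ (κ a) t) first-row ⟩
      (cost (κ a) t + (κ a - 0ℚ) * ι (edges t)) + κ a
        ≡⟨ cong (λ y → (y + (κ a - 0ℚ) * ι (edges t)) + κ a) cost-t ⟩
      ((cost (κ a) p + ((κ a - κ a) + cost (κ a) p)) + (κ a - 0ℚ) * ι (edges t)) + κ a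
        ≡⟨ solve 3 (λ c k m → ((c :+ ((k :- k) :+ c)) :+ (k :- con 0ℚ) :* m) :+ k :=
                               (con 1ℚ :+ con 1ℚ) :* c :+ k :* (con 1ℚ :+ m)) refl (cost (κ a) p) (κ a) (ι (edges t)) ⟩
      2ℚ * cost (κ a) p + κ a * ι (suc (edges t))
        ≡⟨ cong (λ m → 2ℚ * cost (κ a) p + κ a * ι m) size ⟩
      2ℚ * cost (κ a) p + κ a * ι n
        -- Only the walk exhausts the factor 2: steps at the base price `κ a` are counted `n` times
        -- in the tour and `2n` times in the doubled LP.
        ≤⟨ ℚ.+-mono-≤ (SpanningWalk.cheap sw (κ a) (λ b d∤b → min b (λ n∣b → d∤b (∣-trans d∣n n∣b))))
             (*-mono-≤ˡ 0≤κ (subst (ι n ≤_) (sym double) (p≤p+q (ι-nonneg n)))) ⟩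
      W d (κ a) + κ a * (ι n * 2ℚ)
        ≤⟨ total-cost a d d∣n min ⟩
      2ℚ * lpCost n c x ∎)
      where
      open ℚ.≤-Reasoning
      instance _ = nz
      open Serpentine a 1
      d = gcd n a
      d∣n = gcd[m,n]∣m n a
      sw = spanning-walk d (<-wellFounded d) d∣n
      open SpanningWalk sw using (from; to) renaming (walk to p)
      s = serpentine k true p
      t = s ⌢ reverse p
      0≤κ : 0ℚ ≤ κ a
      0≤κ = stripeCost-nonneg (n ℕ./ 2) c 0≤c _
      double : ι n * 2ℚ ≡ ι n + ι n
      double = solve 1 (λ m → m :* (con 1ℚ :+ con 1ℚ) := m :+ m) refl (ι n)
      size : suc (edges t) ≡ n
      size = trans (cong₂ ℕ._+_ (edges-serpentine k true p) (cong suc (edges-reverse p)))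
        (trans (cong (λ l → l ℕ.* suc k ℕ.+ l) (SpanningWalk.size sw))
        (trans (N.solve 2 (λ d k → d N.:* (N.con 1 N.:+ k) N.:+ d N.:= (N.con 2 N.:+ k) N.:* d) refl d k) (sym n≡)))

      covers : Covers n t
      covers z = lift (proj₁ (proj₂ on-p)) (coset-step n a n≡ (proj₂ (proj₂ on-p)))
        where
        on-p = SpanningWalk.covers sw z
        lift : ∀ {y} → y on p → (∃ λ r → r ℕ.< suc (suc k) × Cong n (y ℕ.+ r ℕ.* a) z) →
          ∃ λ y′ → y′ on t × Cong n y′ z
        lift {y} y∈p (zero  , _   , y≅z) = y , on-right (on-reverse y∈p) ,
          subst (λ y → Cong n y z) (ℕ.+-identityʳ y) y≅z
        lift {y} y∈p (suc r , r<m , y≅z) = _ , on-left (on-serpentine k true y∈p (ℕ.≤-pred (ℕ.≤-pred r<m))) ,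
          subst (λ r → Cong n (y ℕ.+ r ℕ.* a) z) (ℕ.+-comm 1 r) y≅z
      tour = walk⇒tour n c t size covers
      first-row : e from (from ℕ.+ 1 ℕ.* a) ≡ κ a
      first-row = trans (cong (λ u → e u (from ℕ.+ 1 ℕ.* a)) (sym (ℕ.+-identityʳ from))) (e-row e-sym e-translate a 1 from 0)
      ma≅0 : ∀ y → Cong n (y ℕ.+ suc (suc k) ℕ.* a) y
      ma≅0 y = cong-mod 0 q (Eq.begin
        y ℕ.+ suc (suc k) ℕ.* a ℕ.+ 0  Eq.≡⟨ ℕ.+-identityʳ _ ⟩
        y ℕ.+ suc (suc k) ℕ.* a        Eq.≡⟨ cong (λ b → y ℕ.+ suc (suc k) ℕ.* b) a≡ ⟩
        y ℕ.+ suc (suc k) ℕ.* (q ℕ.* d)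
          Eq.≡⟨ N.solve 4 (λ y m q d → y N.:+ m N.:* (q N.:* d) N.:= y N.:+ q N.:* (m N.:* d)) refl y (suc (suc k)) q d ⟩
        y ℕ.+ q ℕ.* (suc (suc k) ℕ.* d) Eq.≡⟨ cong (λ n → y ℕ.+ q ℕ.* n) (sym n≡) ⟩
        y ℕ.+ q ℕ.* n Eq.∎)
        where
        q = _∣_.quotient (gcd[m,n]∣n n a)
        a≡ : a ≡ q ℕ.* d
        a≡ = _∣_.equality (gcd[m,n]∣n n a)
        module Eq = ≡-Reasoning
      -- The rows close up cyclically, as `suc (suc k) * a` is a multiple of `n`. So row 0 is
      -- adjacent both to row 1 and to row `suc k`, wherever the serpentine ends.
      turn : ∀ b → e (to ℕ.+ finish k b ℕ.* a) to ≡ κ a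
      turn true  = trans (e-Cong (Cong-reflexive refl) (Cong-sym (ma≅0 to)))
        (trans (cong (λ r → e (to ℕ.+ r ℕ.* a) (to ℕ.+ suc (suc k) ℕ.* a)) (ℕ.+-comm k 1))
               (e-row e-sym e-translate a 1 to (suc k)))
      turn false = trans (e-sym _ to)
        (trans (cong (λ u → e u (to ℕ.+ 1 ℕ.* a)) (sym (ℕ.+-identityʳ to))) (e-row e-sym e-translate a 1 to 0))
      cost-t : cost (κ a) t ≡ cost (κ a) p + ((κ a - κ a) + cost (κ a) p)
      cost-t = cong₂ _+_ (cost-serpentine e-sym e-translate a 1 k true p)
        (cong₂ (λ y z → (y - κ a) + z) (turn (exit k true p)) (cost-reverse e-sym (κ a) p))

    upper-bound : 1 ℕ.< n → ∃ λ σ → tourCost n c σ ≤ 2ℚ * lpCost n c x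
    upper-bound 1<n = cylinder-tour (proj₁ choice) (proj₂ (proj₂ choice))
      (gcd-quotient n (proj₁ choice) (proj₁ (proj₂ choice)))
      where choice = cheapest n ∣-refl 1<n

-- The lower bound: Möbius ladders with an even number of rungs.

module Lower where

  open Sums
  open Stripes
  open Walks
  open import Data.Nat as ℕ using (ℕ; zero; suc; NonZero; _∸_; _⊓_)
  import Data.Nat.Properties as ℕ
  open import Data.Nat.Solver using () renaming (module +-*-Solver to N)
  open import Data.Nat.DivMod using (_mod_; m*n/n≡m)
  open import Data.Bool using (Bool; T; true; false; not; _∧_; _xor_; if_then_else_)
  import Data.Bool.Properties as Bool
  open import Data.Bool.Solver using (module xor-∧-Solver)
  open import Data.Fin using (Fin; zero; suc; toℕ; fromℕ<; inject₁; fromℕ)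
  import Data.Fin.Properties as Fin
  open import Data.Fin.Permutation using (Permutation′; _⟨$⟩ʳ_; _⟨$⟩ˡ_; inverseʳ; inverseˡ)
  open import Data.Product using (_×_; _,_; ∃)
  import Data.Sum
  open import Data.Sum using (_⊎_; inj₁; inj₂)
  open import Data.Empty using (⊥; ⊥-elim)
  open import Relation.Nullary using (Dec; yes; no)
  open import Relation.Nullary.Decidable using (from-yes)
  open import Relation.Binary.Definitions using (tri<; tri≈; tri>)
  open import Relation.Binary.PropositionalEquality
  open import Data.Rational using (ℚ; 0ℚ; 1ℚ; ½; _+_; _*_; _-_; _≤_; _<_)
  import Data.Rational.Properties as ℚ
  open import Data.Rational.Solver using (module +-*-Solver)
  open +-*-Solver using (solve; _:+_; _:*_; _:-_; _:=_; con)

  indicator : Bool → ℚ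
  indicator b = if b then 1ℚ else 0ℚ

  indicator-nonneg : ∀ b → 0ℚ ≤ indicator b
  indicator-nonneg true  = 0≤1
  indicator-nonneg false = ℚ.≤-refl

  indicator-≤1 : ∀ b → indicator b ≤ 1ℚ
  indicator-≤1 true  = ℚ.≤-refl
  indicator-≤1 false = 0≤1

  indicator-true : ∀ {b} → b ≡ true → 1ℚ ≤ indicator b
  indicator-true refl = ℚ.≤-refl

  if-indicator : ∀ b p → (if b then p else 0ℚ) ≡ indicator b * p
  if-indicator true  p = sym (ℚ.*-identityˡ p)
  if-indicator false p = sym (ℚ.*-zeroˡ p)

  parity : ℕ → Bool
  parity zero    = false
  parity (suc n) = not (parity n)

  parity-+ : ∀ m n → parity (m ℕ.+ n) ≡ parity m xor parity n
  parity-+ zero    n = refl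
  parity-+ (suc m) n = trans (cong not (parity-+ m n)) (Bool.not-distribˡ-xor (parity m) (parity n))

  parity-double : ∀ m → parity (m ℕ.+ m) ≡ false
  parity-double m = trans (parity-+ m m) (Bool.xor-same (parity m))

  xorΣ : ∀ n → (Fin n → Bool) → Bool
  xorΣ zero    f = false
  xorΣ (suc n) f = f zero xor xorΣ n (λ i → f (suc i))

  xorΣ-cong : ∀ n {f g : Fin n → Bool} → (∀ i → f i ≡ g i) → xorΣ n f ≡ xorΣ n g
  xorΣ-cong zero    eq = refl
  xorΣ-cong (suc n) eq = cong₂ _xor_ (eq zero) (xorΣ-cong n (λ i → eq (suc i)))

  xorΣ-last : ∀ n (f : Fin (suc n) → Bool) → xorΣ (suc n) f ≡ xorΣ n (λ i → f (inject₁ i)) xor f (fromℕ n)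
  xorΣ-last zero    f = Bool.xor-comm (f zero) false
  xorΣ-last (suc n) f = trans (cong (f zero xor_) (xorΣ-last n (λ i → f (suc i))))
    (sym (Bool.xor-assoc (f zero) _ _))

  xorΣ-telescope : ∀ n (t : Fin (suc n) → Bool) →
    xorΣ n (λ k → not (t (inject₁ k) xor t (suc k))) ≡ parity n xor (t zero xor t (fromℕ n))
  xorΣ-telescope zero    t = sym (Bool.xor-same (t zero))
  xorΣ-telescope (suc n) t = trans (cong (not (t zero xor t (suc zero)) xor_) (xorΣ-telescope n (λ k → t (suc k))))
    (merge (t zero) (t (suc zero)) (t (fromℕ (suc n))) (parity n))
    where
    open xor-∧-Solver renaming (solve to solveᵇ; _:+_ to _⊕_; _:=_ to _≈_; con to conᵇ)
    merge : ∀ a b c p → not (a xor b) xor (p xor (b xor c)) ≡ not p xor (a xor c)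
    merge = solveᵇ 4 (λ a b c p → (conᵇ true ⊕ (a ⊕ b)) ⊕ (p ⊕ (b ⊕ c)) ≈ (conᵇ true ⊕ p) ⊕ (a ⊕ c)) refl

  -- Around the cycle the differences of `t` cancel, leaving one negation for each step.
  xorΣ-cyclic : ∀ n (t : Fin n → Bool) → xorΣ n (λ k → not (t k xor t (next k))) ≡ parity n
  xorΣ-cyclic zero    t = refl
  xorΣ-cyclic (suc m) t = begin
    xorΣ (suc m) (λ k → not (t k xor t (next k)))
      ≡⟨ xorΣ-last m (λ k → not (t k xor t (next k))) ⟩
    xorΣ m (λ k → not (t (inject₁ k) xor t (next (inject₁ k)))) xor not (t (fromℕ m) xor t (next (fromℕ m)))
      ≡⟨ cong₂ _xor_ (xorΣ-cong m (λ k → cong (λ j → not (t (inject₁ k) xor t j)) (next-inject₁ k)))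
           (cong (λ j → not (t (fromℕ m) xor t j)) (next-fromℕ m)) ⟩
    xorΣ m (λ k → not (t (inject₁ k) xor t (suc k))) xor not (t (fromℕ m) xor t zero)
      ≡⟨ cong (_xor not (t (fromℕ m) xor t zero)) (xorΣ-telescope m t) ⟩
    (parity m xor (t zero xor t (fromℕ m))) xor not (t (fromℕ m) xor t zero)
      ≡⟨ merge (t zero) (t (fromℕ m)) (parity m) ⟩
    not (parity m) ∎
    where
    open ≡-Reasoning
    open xor-∧-Solver renaming (solve to solveᵇ; _:+_ to _⊕_; _:=_ to _≈_; con to conᵇ)
    merge : ∀ a c p → (p xor (a xor c)) xor not (c xor a) ≡ not p
    merge = solveᵇ 3 (λ a c p → (p ⊕ (a ⊕ c)) ⊕ (conᵇ true ⊕ (c ⊕ a)) ≈ conᵇ true ⊕ p) refl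

  next-invariant⇒const : ∀ n (s : Fin n → Bool) → (∀ k → s k ≡ s (next k)) → ∀ j k → s j ≡ s k
  next-invariant⇒const (suc m) s inv j k = trans (from-zero m s step j) (sym (from-zero m s step k))
    where
    step : ∀ k → s (inject₁ k) ≡ s (suc k)
    step k = trans (inv (inject₁ k)) (cong s (next-inject₁ k))
    from-zero : ∀ m (s : Fin (suc m) → Bool) → (∀ k → s (inject₁ k) ≡ s (suc k)) → ∀ k → s k ≡ s zero
    from-zero m       s step zero    = refl
    from-zero (suc m) s step (suc k) =
      trans (from-zero m (λ k → s (suc k)) (λ k → step (suc k)) k) (sym (step zero))

  next-≢ : ∀ n → 1 ℕ.< n → (k : Fin n) → k ≢ next k
  next-≢ (suc m) 1<n k k≡next with suc (toℕ k) ℕ.<? suc m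
  ... | yes p = ℕ.1+n≢n (sym (trans (cong toℕ k≡next) (Fin.toℕ-fromℕ< p)))
  ... | no ¬p = ¬p (subst (λ k → suc (toℕ k) ℕ.< suc m) (sym k≡next) 1<n)

  odd⇒1≤Σ : ∀ n (f : Fin n → Bool) → xorΣ n f ≡ true → 1ℚ ≤ Σ n (λ k → indicator (f k))
  odd⇒1≤Σ (suc n) f odd = go (f zero) odd
    where
    rest = λ k → f (suc k)
    go : ∀ b → b xor xorΣ n rest ≡ true → 1ℚ ≤ indicator b + Σ n (λ k → indicator (rest k))
    go true  _   = p≤p+q (Σ-nonneg n (λ k → indicator-nonneg (rest k)))
    go false odd = ℚ.≤-trans (odd⇒1≤Σ n rest odd) (q≤p+q ℚ.≤-refl)

  -- Removing the first true entry leaves an odd count, which is at least 1.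
  even∧nonzero⇒2≤Σ : ∀ n (f : Fin n → Bool) → xorΣ n f ≡ false → ∃ (λ k → f k ≡ true) →
    2ℚ ≤ Σ n (λ k → indicator (f k))
  even∧nonzero⇒2≤Σ (suc n) f even (k , fk) = go (f zero) refl even k fk
    where
    rest = λ k → f (suc k)
    go : ∀ b → f zero ≡ b → b xor xorΣ n rest ≡ false → ∀ k → f k ≡ true →
      2ℚ ≤ indicator b + Σ n (λ k → indicator (rest k))
    go true  _  even _ _ = ℚ.+-monoʳ-≤ 1ℚ (odd⇒1≤Σ n rest (trans (sym (Bool.not-involutive _)) (cong not even)))
    go false f₀ even zero f₀′ with () ← trans (sym f₀) f₀′
    go false f₀ even (suc k) fk =
      ℚ.≤-trans (even∧nonzero⇒2≤Σ n rest even (k , fk)) (q≤p+q ℚ.≤-refl)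

  -- At most one entry is below 2. If it is the first one, all others are large; otherwise the first
  -- can be split off. The exceptional entry is made up for by the summand `2ℚ`.
  all-but-one : ∀ g (K : Fin g → ℚ) → (∀ b → 0ℚ ≤ K b) → (∀ a b → a ≢ b → 2ℚ ≤ K a ⊎ 2ℚ ≤ K b) →
    ι g * 2ℚ ≤ Σ g K + 2ℚ
  all-but-one zero    K 0≤K alt = from-yes (0ℚ * 2ℚ ℚ.≤? 0ℚ + 2ℚ)
  all-but-one (suc g) K 0≤K alt = go (2ℚ ℚ.≤? K zero)
    where
    open ℚ.≤-Reasoning
    rest = λ b → K (suc b)
    split : ι (suc g) * 2ℚ ≡ 2ℚ + ι g * 2ℚ
    split = solve 1 (λ m → (con 1ℚ :+ m) :* (con 1ℚ :+ con 1ℚ) := (con 1ℚ :+ con 1ℚ) :+ m :* (con 1ℚ :+ con 1ℚ)) refl (ι g)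
    go : Dec (2ℚ ≤ K zero) → ι (suc g) * 2ℚ ≤ Σ (suc g) K + 2ℚ
    go (yes 2≤K₀) = begin
      ι (suc g) * 2ℚ             ≡⟨ split ⟩
      2ℚ + ι g * 2ℚ              ≤⟨ ℚ.+-mono-≤ 2≤K₀ (all-but-one g rest (λ b → 0≤K (suc b))
                                       (λ a b a≢b → alt (suc a) (suc b) (λ eq → a≢b (Fin.suc-injective eq)))) ⟩
      K zero + (Σ g rest + 2ℚ)   ≡⟨ sym (ℚ.+-assoc (K zero) (Σ g rest) 2ℚ) ⟩
      Σ (suc g) K + 2ℚ           ∎
    go (no 2≰K₀) = begin
      ι (suc g) * 2ℚ             ≡⟨ split ⟩
      2ℚ + ι g * 2ℚ              ≡⟨ ℚ.+-comm 2ℚ (ι g * 2ℚ) ⟩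
      ι g * 2ℚ + 2ℚ              ≡⟨ cong (_+ 2ℚ) (sym (Σ-const g 2ℚ)) ⟩
      Σ g (λ _ → 2ℚ) + 2ℚ        ≤⟨ ℚ.+-monoˡ-≤ 2ℚ (Σ-mono g others) ⟩
      Σ g rest + 2ℚ              ≤⟨ ℚ.+-monoˡ-≤ 2ℚ (q≤p+q (0≤K zero)) ⟩
      Σ (suc g) K + 2ℚ           ∎
      where
      others : ∀ b → 2ℚ ≤ rest b
      others b with alt zero (suc b) (λ ())
      ... | inj₁ 2≤K₀ = ⊥-elim (2≰K₀ 2≤K₀)
      ... | inj₂ 2≤Kb = 2≤Kb

  stripeCost-in-range : ∀ d (C : ℕ → ℚ) k → 0 ℕ.< k → k ℕ.≤ d → stripeCost d (λ i → C (suc (toℕ i))) k ≡ C k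
  stripeCost-in-range (suc d) C (suc zero)    _ _           = refl
  stripeCost-in-range (suc d) C (suc (suc k)) _ (ℕ.s≤s k≤d) = stripeCost-in-range d (λ k → C (suc k)) (suc k) ℕ.z<s k≤d

  descent : ∀ (s : ℕ → Bool) k → s 0 ≡ true → s k ≡ false → ∃ λ m → s m ≡ true × s (suc m) ≡ false
  descent s zero    s₀ sₖ with () ← trans (sym s₀) sₖ
  descent s (suc k) s₀ sₖ with s 1 in s₁
  ... | false = 0 , s₀ , s₁
  ... | true with descent (λ m → s (suc m)) k s₁ sₖ
  ...   | m , sₘ , sₘ₊₁ = suc m , sₘ , sₘ₊₁

  -- The instance: a cycle of length n = 2g at cost 1 per edge, with its diameters for free.
  module MobiusLadder (n g : ℕ) .{{_ : NonZero n}} (n≡ : n ≡ g ℕ.+ g) (g-even : parity g ≡ false) (2<g : 2 ℕ.< g) where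

    g<n : g ℕ.< n
    g<n = subst (g ℕ.<_) (sym n≡) (ℕ.m<m+n g (ℕ.<-trans ℕ.z<s 2<g))

    1<g : 1 ℕ.< g
    1<g = ℕ.<-trans (ℕ.n<1+n 1) 2<g

    1<n : 1 ℕ.< n
    1<n = ℕ.<-trans 1<g g<n

    n∸1<n : n ∸ 1 ℕ.< n
    n∸1<n = ℕ.∸-monoʳ-< {n} ℕ.z<s (ℕ.<⇒≤ 1<n)

    n∸g≡g : n ∸ g ≡ g
    n∸g≡g = trans (cong (_∸ g) n≡) (ℕ.m+n∸m≡n g g)

    g<n∸1 : g ℕ.< n ∸ 1
    g<n∸1 = ℕ.≤-trans (ℕ.≤-trans (ℕ.≤-reflexive (ℕ.+-comm 1 g)) (ℕ.+-monoʳ-≤ g (ℕ.<⇒≤pred 1<g)))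
      (ℕ.≤-reflexive (trans (sym (ℕ.+-∸-assoc g (ℕ.<⇒≤ 1<g))) (cong (_∸ 1) (sym n≡))))

    n/2≡g : n ℕ./ 2 ≡ g
    n/2≡g = trans (cong (ℕ._/ 2) (trans n≡ (trans (cong (g ℕ.+_) (sym (ℕ.+-identityʳ g))) (ℕ.*-comm 2 g)))) (m*n/n≡m g 2)

    -- A chord that is neither a cycle edge nor a diameter satisfies `crosses b` for at most all `g`
    -- values of `b`; the price `ι g` covers this without a closer look.
    price : ℕ → ℚ
    price k = if k ℕ.≡ᵇ 1 then 1ℚ else (if k ℕ.≡ᵇ g then 0ℚ else ι g)

    price-g : price g ≡ 0ℚ
    price-g = trans (cong (λ b → if b then 1ℚ else (if g ℕ.≡ᵇ g then 0ℚ else ι g)) (≢⇒≡ᵇ≡false (λ g≡1 → ℕ.<⇒≢ 1<g (sym g≡1))))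
      (cong (λ b → if b then 0ℚ else ι g) (≡⇒≡ᵇ≡true {g} refl))

    c : Fin (n ℕ./ 2) → ℚ
    c k = price (suc (toℕ k))

    c-nonneg : ∀ k → 0ℚ ≤ c k
    c-nonneg k = price-nonneg (suc (toℕ k) ℕ.≡ᵇ 1) (suc (toℕ k) ℕ.≡ᵇ g)
      where
      price-nonneg : ∀ p q → 0ℚ ≤ (if p then 1ℚ else (if q then 0ℚ else ι g))
      price-nonneg true  _     = 0≤1
      price-nonneg false true  = ℚ.≤-refl
      price-nonneg false false = ι-nonneg g

    rot : ℕ → Fin n → Fin n
    rot a i = (toℕ i ℕ.+ a) mod n

    rot-Cong : ∀ a i → Cong n (toℕ (rot a i)) (toℕ i ℕ.+ a)
    rot-Cong a i = Cong-trans (Cong-reflexive (toℕ-mod n _)) (Cong-% n _)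

    rot-injective : ∀ {a b} i → a ℕ.< n → b ℕ.< n → rot a i ≡ rot b i → a ≡ b
    rot-injective {a} {b} i a<n b<n eq = Cong-<⇒≡ n a<n b<n (Cong-+-cancel (toℕ i)
      (Cong-trans (Cong-reflexive (ℕ.+-comm a (toℕ i))) (Cong-trans (Cong-sym (rot-Cong a i))
      (Cong-trans (Cong-reflexive (cong toℕ eq)) (Cong-trans (rot-Cong b i) (Cong-reflexive (ℕ.+-comm (toℕ i) b)))))))

    rot-0 : ∀ i → rot 0 i ≡ i
    rot-0 i = trans (cong (_mod n) (ℕ.+-identityʳ (toℕ i))) (mod-toℕ n i)

    rot-≢ : ∀ {a} i → 0 ℕ.< a → a ℕ.< n → i ≢ rot a i
    rot-≢ i 0<a a<n eq = ℕ.<⇒≢ 0<a (rot-injective i (ℕ.<-trans 0<a a<n) a<n (trans (rot-0 i) eq))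

    rot-rot : ∀ a b i → rot b (rot a i) ≡ rot (a ℕ.+ b) i
    rot-rot a b i = Cong⇒mod≡ n (Cong-trans (Cong-+ b (rot-Cong a i)) (Cong-reflexive (ℕ.+-assoc (toℕ i) a b)))

    rot-n : ∀ a i → rot (a ℕ.+ n) i ≡ rot a i
    rot-n a i = Cong⇒mod≡ n (Cong-trans (Cong-reflexive (sym (ℕ.+-assoc (toℕ i) a n))) (Cong-+-modulus (toℕ i ℕ.+ a)))

    stripe-rot : ∀ a i → 0 ℕ.< a → a ℕ.< n → stripe n i (rot a i) ≡ (n ∸ a) ⊓ a
    stripe-rot a i 0<a a<n = cong₂ _⊓_
      (diffMod-unique n i (rot a i) (ℕ.∸-monoʳ-< {n} 0<a (ℕ.<⇒≤ a<n))
        (Cong-trans (Cong-reflexive (ℕ.+-comm (n ∸ a) _)) (Cong-trans (Cong-+ (n ∸ a) (rot-Cong a i))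
        (Cong-trans (Cong-reflexive (trans (ℕ.+-assoc (toℕ i) a _) (cong (toℕ i ℕ.+_) (ℕ.m+[n∸m]≡n (ℕ.<⇒≤ a<n)))))
          (Cong-+-modulus (toℕ i))))))
      (diffMod-unique n (rot a i) i a<n (Cong-trans (Cong-reflexive (ℕ.+-comm a (toℕ i))) (Cong-sym (rot-Cong a i))))

    stripe-≤g : ∀ a → a ℕ.< n → (n ∸ a) ⊓ a ℕ.≤ g
    stripe-≤g a a<n with ℕ.≤-total a g
    ... | inj₁ a≤g = ℕ.≤-trans (ℕ.m⊓n≤n (n ∸ a) a) a≤g
    ... | inj₂ g≤a = ℕ.≤-trans (ℕ.m⊓n≤m (n ∸ a) a) (ℕ.≤-trans (ℕ.∸-monoʳ-≤ n g≤a) (ℕ.≤-reflexive n∸g≡g))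

    edgeCost-rot : ∀ a i → 0 ℕ.< a → a ℕ.< n → edgeCost n c i (rot a i) ≡ price ((n ∸ a) ⊓ a)
    edgeCost-rot a i 0<a a<n = trans (cong (stripeCost (n ℕ./ 2) c) (stripe-rot a i 0<a a<n))
      (stripeCost-in-range (n ℕ./ 2) price ((n ∸ a) ⊓ a)
        (ℕ.⊓-glb (ℕ.m<n⇒0<n∸m a<n) 0<a)
        (subst ((n ∸ a) ⊓ a ℕ.≤_) (sym n/2≡g) (stripe-≤g a a<n)))

    -- Tours

    -- For `b < g` this half of the cycle contains exactly one end of every diameter. In the ladder
    -- its boundary therefore consists of all rungs and the two cycle edges between the rungs `b`
    -- and `b + 1`.
    arc : ℕ → ℕ → Bool
    arc b u = (b ℕ.<ᵇ u) ∧ (u ℕ.≤ᵇ b ℕ.+ g)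

    arc-inside : ∀ {b u} → b ℕ.< u → u ℕ.≤ b ℕ.+ g → arc b u ≡ true
    arc-inside {b} {u} b<u u≤b+g = cong₂ _∧_ (T⇒≡true (ℕ.<⇒<ᵇ b<u)) (T⇒≡true (ℕ.≤⇒≤ᵇ u≤b+g))
      where
      T⇒≡true : ∀ {b} → T b → b ≡ true
      T⇒≡true {true} _ = refl

    arc-below : ∀ {b u} → u ℕ.≤ b → arc b u ≡ false
    arc-below {b} {u} u≤b with b ℕ.<ᵇ u in eq
    ... | false = refl
    ... | true  = ⊥-elim (ℕ.≤⇒≯ u≤b (ℕ.<ᵇ⇒< b u (subst T (sym eq) _)))

    arc-above : ∀ {b u} → b ℕ.+ g ℕ.< u → arc b u ≡ false
    arc-above {b} {u} b+g<u with u ℕ.≤ᵇ b ℕ.+ g in eq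
    ... | false = Bool.∧-zeroʳ (b ℕ.<ᵇ u)
    ... | true  = ⊥-elim (ℕ.<⇒≱ b+g<u (ℕ.≤ᵇ⇒≤ u (b ℕ.+ g) (subst T (sym eq) _)))

    colour : ℕ → ℕ → Bool
    colour b u = arc b u xor parity u

    -- For an edge uv of the ladder this says that uv joins the rungs b and b + 1 (mod g):
    -- the parity colouring cancels the rungs from the boundary of the arc {b+1,...,b+g}.
    -- In this form, the number of such edges on a closed walk of even length is visibly even.
    crosses : ℕ → ℕ → ℕ → Bool
    crosses b u v = not (colour b u xor colour b v)

    crosses-sym : ∀ b u v → crosses b u v ≡ crosses b v u
    crosses-sym b u v = cong not (Bool.xor-comm (colour b u) (colour b v))

    crosses-arc : ∀ b u v p → parity u xor parity v ≡ p → crosses b u v ≡ not ((arc b u xor arc b v) xor p)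
    crosses-arc b u v p refl = cong not (solveᵇ 4 (λ a p a′ p′ → (a ⊕ p) ⊕ (a′ ⊕ p′) ≈ (a ⊕ a′) ⊕ (p ⊕ p′)) refl
      (arc b u) (parity u) (arc b v) (parity v))
      where open xor-∧-Solver renaming (solve to solveᵇ; _:+_ to _⊕_; _:=_ to _≈_; con to conᵇ)

    crosses-odd : ∀ b u v → parity u xor parity v ≡ true → arc b u ≡ arc b v → crosses b u v ≡ false
    crosses-odd b u v odd eq = trans (crosses-arc b u v true odd)
      (trans (cong (λ t → not ((t xor arc b v) xor true)) eq) (cong (λ t → not (t xor true)) (Bool.xor-same (arc b v))))

    n-even : parity n ≡ false
    n-even = trans (cong parity n≡) (parity-double g)

    -- Evenness of `g` enters here: the ends of a rung have equal parity, while exactly one of them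
    -- lies in the arc.
    crosses-rung : ∀ b u → b ℕ.< g → u ℕ.+ g ℕ.< n → crosses b u (u ℕ.+ g) ≡ false
    crosses-rung b u b<g u+g<n = trans (crosses-arc b u (u ℕ.+ g) false even)
      (opposite (ℕ.≤-total u b))
      where
      even : parity u xor parity (u ℕ.+ g) ≡ false
      even = trans (cong (parity u xor_) (trans (parity-+ u g) (trans (cong (parity u xor_) g-even)
        (Bool.xor-identityʳ (parity u))))) (Bool.xor-same (parity u))
      u<g : u ℕ.< g
      u<g = ℕ.+-cancelʳ-< g u g (subst (u ℕ.+ g ℕ.<_) n≡ u+g<n)
      opposite : u ℕ.≤ b ⊎ b ℕ.≤ u → not ((arc b u xor arc b (u ℕ.+ g)) xor false) ≡ false
      opposite (inj₁ u≤b) = cong₂ (λ s t → not ((s xor t) xor false)) (arc-below u≤b)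
        (arc-inside (ℕ.<-≤-trans b<g (ℕ.m≤n+m g u)) (ℕ.+-monoˡ-≤ g u≤b))
      opposite (inj₂ b≤u) with b ℕ.≟ u
      ... | yes refl = cong₂ (λ s t → not ((s xor t) xor false)) (arc-below {b} ℕ.≤-refl)
        (arc-inside (ℕ.<-≤-trans b<g (ℕ.m≤n+m g b)) ℕ.≤-refl)
      ... | no  b≢u  = cong₂ (λ s t → not ((s xor t) xor false))
        (arc-inside (ℕ.≤∧≢⇒< b≤u b≢u) (ℕ.≤-trans (ℕ.<⇒≤ u<g) (ℕ.m≤n+m g b)))
        (arc-above (ℕ.+-monoˡ-< g (ℕ.≤∧≢⇒< b≤u b≢u)))

    clash : ∀ {b} {A : Set} → b ≡ true → b ≡ false → A
    clash refl ()

    parity-step : ∀ u → parity u xor parity (u ℕ.+ 1) ≡ true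
    parity-step u = trans (cong (λ v → parity u xor parity v) (ℕ.+-comm u 1))
      (trans (sym (Bool.not-distribʳ-xor (parity u) (parity u))) (cong not (Bool.xor-same (parity u))))

    crosses-step : ∀ b u → crosses b u (u ℕ.+ 1) ≡ true → u ≡ b ⊎ u ≡ b ℕ.+ g
    crosses-step b u cr with ℕ.<-cmp u b | ℕ.<-cmp u (b ℕ.+ g)
    ... | tri≈ _ u≡b _ | _              = inj₁ u≡b
    ... | tri< _ _ _   | tri≈ _ u≡ _    = inj₂ u≡
    ... | tri> _ _ _   | tri≈ _ u≡ _    = inj₂ u≡
    ... | tri< u<b _ _ | tri< _ _ _     = clash cr (crosses-odd b u (u ℕ.+ 1) (parity-step u)
      (trans (arc-below (ℕ.<⇒≤ u<b)) (sym (arc-below (subst (ℕ._≤ b) (ℕ.+-comm 1 u) u<b)))))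
    ... | tri< u<b _ _ | tri> _ _ b+g<u = ⊥-elim (ℕ.<-asym u<b (ℕ.≤-<-trans (ℕ.m≤m+n b g) b+g<u))
    ... | tri> _ _ b<u | tri< u<b+g _ _ = clash cr (crosses-odd b u (u ℕ.+ 1) (parity-step u)
      (trans (arc-inside b<u (ℕ.<⇒≤ u<b+g))
        (sym (arc-inside (ℕ.<-≤-trans b<u (ℕ.m≤m+n u 1)) (subst (ℕ._≤ b ℕ.+ g) (ℕ.+-comm 1 u) u<b+g)))))
    ... | tri> _ _ b<u | tri> _ _ b+g<u = clash cr (crosses-odd b u (u ℕ.+ 1) (parity-step u)
      (trans (arc-above b+g<u) (sym (arc-above (ℕ.<-≤-trans b+g<u (ℕ.m≤m+n u 1))))))

    crosses-step-unique : ∀ u {b b′} → b ℕ.< g → b′ ℕ.< g →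
      crosses b u (u ℕ.+ 1) ≡ true → crosses b′ u (u ℕ.+ 1) ≡ true → b ≡ b′
    crosses-step-unique u {b} {b′} b<g b′<g cr cr′ with crosses-step b u cr | crosses-step b′ u cr′
    ... | inj₁ u≡b  | inj₁ u≡b′  = trans (sym u≡b) u≡b′
    ... | inj₁ u≡b  | inj₂ u≡b′  = ⊥-elim (ℕ.<⇒≱ b<g (subst (g ℕ.≤_) (trans (sym u≡b′) u≡b) (ℕ.m≤n+m g b′)))
    ... | inj₂ u≡b  | inj₁ u≡b′  = ⊥-elim (ℕ.<⇒≱ b′<g (subst (g ℕ.≤_) (trans (sym u≡b) u≡b′) (ℕ.m≤n+m g b)))
    ... | inj₂ u≡b  | inj₂ u≡b′  = ℕ.+-cancelʳ-≡ g b b′ (trans (sym u≡b) u≡b′)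

    -- No arc contains 0, and the arc of `b` reaches `n ∸ 1` only for the last `b`; otherwise both
    -- ends are outside and have opposite parity.
    crosses-closing : ∀ b → b ℕ.< g → crosses b 0 (n ∸ 1) ≡ true → suc b ≡ g
    crosses-closing b b<g cr with suc b ℕ.≟ g
    ... | yes eq = eq
    ... | no  ne = clash cr (crosses-odd b 0 (n ∸ 1) odd
      (trans (arc-below {b} ℕ.z≤n) (sym (arc-above above))))
      where
      odd : parity (n ∸ 1) ≡ true
      odd = trans (sym (Bool.not-involutive _)) (cong not (trans (cong parity (ℕ.suc-pred n)) n-even))
      above : b ℕ.+ g ℕ.< n ∸ 1
      above = ℕ.<⇒≤pred (subst (suc (suc b ℕ.+ g) ℕ.≤_) (sym n≡) (ℕ.+-monoˡ-≤ g (ℕ.≤∧≢⇒< b<g ne)))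

    price-other : ∀ {k} → k ≢ 1 → k ≢ g → price k ≡ ι g
    price-other {k} k≢1 k≢g =
      trans (cong (λ b → if b then 1ℚ else (if k ℕ.≡ᵇ g then 0ℚ else ι g)) (≢⇒≡ᵇ≡false k≢1))
        (cong (λ b → if b then 0ℚ else ι g) (≢⇒≡ᵇ≡false k≢g))

    crossing : Fin n → Fin n → Fin g → Bool
    crossing i j b = crosses (toℕ b) (toℕ i) (toℕ j)

    crossing-rot : ∀ a (i : Fin n) → 0 ℕ.< a → toℕ i ℕ.+ a ℕ.< n →
      Σ g (λ b → indicator (crosses (toℕ b) (toℕ i) (toℕ i ℕ.+ a))) ≤ price ((n ∸ a) ⊓ a)
    crossing-rot a i 0<a i+a<n = cases (a ℕ.≟ 1) (a ℕ.≟ g) (a ℕ.≟ n ∸ 1)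
      where
      a<n = ℕ.≤-<-trans (ℕ.m≤n+m a (toℕ i)) i+a<n
      bound = λ k → Σ g (λ b → indicator (crosses (toℕ b) (toℕ i) (toℕ i ℕ.+ a))) ≤ price k
      cases : Dec (a ≡ 1) → Dec (a ≡ g) → Dec (a ≡ n ∸ 1) → bound ((n ∸ a) ⊓ a)
      cases (yes refl) _ _ = subst bound (sym (ℕ.m≥n⇒m⊓n≡n (ℕ.m<n⇒0<n∸m 1<n)))
        (Σ-≤-unique g _ 0≤1 (λ b b′ cr cr′ →
          Fin.toℕ-injective (crosses-step-unique (toℕ i) (Fin.toℕ<n b) (Fin.toℕ<n b′) cr cr′)))
      cases (no _) (yes refl) _ = subst bound (sym (trans (cong (_⊓ g) n∸g≡g) (ℕ.⊓-idem g)))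
        (ℚ.≤-reflexive (trans (Σ-cong g (λ b → cong indicator (crosses-rung (toℕ b) (toℕ i) (Fin.toℕ<n b) i+a<n)))
          (trans (Σ-zero g) (sym price-g))))
      -- Edges are listed from the smaller to the larger end, so the cycle edge that closes up at 0
      -- appears with difference `n ∸ 1` instead of 1.
      cases (no _) (no _) (yes refl) = subst bound
        (sym (trans (cong (_⊓ (n ∸ 1)) (ℕ.m∸[m∸n]≡n (ℕ.<⇒≤ 1<n))) (ℕ.m≤n⇒m⊓n≡m (ℕ.m<n⇒0<n∸m 1<n))))
        (Σ-≤-unique g _ 0≤1 (λ b b′ cr cr′ → Fin.toℕ-injective (ℕ.suc-injective
          (trans (closing b cr) (sym (closing b′ cr′))))))
        where
        i≡0 : toℕ i ≡ 0
        i≡0 = ℕ.n<1⇒n≡0 (ℕ.+-cancelʳ-< (n ∸ 1) (toℕ i) 1 (subst (toℕ i ℕ.+ (n ∸ 1) ℕ.<_) (sym (ℕ.m+[n∸m]≡n (ℕ.<⇒≤ 1<n))) i+a<n))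
        closing : ∀ b → crosses (toℕ b) (toℕ i) (toℕ i ℕ.+ (n ∸ 1)) ≡ true → suc (toℕ b) ≡ g
        closing b cr = crosses-closing (toℕ b) (Fin.toℕ<n b)
          (subst (λ u → crosses (toℕ b) u (u ℕ.+ (n ∸ 1)) ≡ true) i≡0 cr)
      cases (no a≢1) (no a≢g) (no a≢n∸1) = begin
        Σ g (λ b → indicator (crosses (toℕ b) (toℕ i) (toℕ i ℕ.+ a)))  ≤⟨ Σ-mono g (λ b → indicator-≤1 _) ⟩
        Σ g (λ _ → 1ℚ)                                                  ≡⟨ trans (Σ-const g 1ℚ) (ℚ.*-identityʳ (ι g)) ⟩
        ι g                                                             ≡⟨ sym (price-other ≢1 ≢g) ⟩
        price ((n ∸ a) ⊓ a)                                             ∎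
        where
        open ℚ.≤-Reasoning
        n∸[n∸a]≡a : n ∸ (n ∸ a) ≡ a
        n∸[n∸a]≡a = ℕ.m∸[m∸n]≡n (ℕ.<⇒≤ a<n)
        ≢1 : (n ∸ a) ⊓ a ≢ 1
        ≢1 eq with ℕ.⊓-sel (n ∸ a) a
        ... | inj₁ left  = a≢n∸1 (trans (sym n∸[n∸a]≡a) (cong (n ∸_) (trans (sym left) eq)))
        ... | inj₂ right = a≢1 (trans (sym right) eq)
        ≢g : (n ∸ a) ⊓ a ≢ g
        ≢g eq with ℕ.⊓-sel (n ∸ a) a
        ... | inj₁ left  = a≢g (trans (sym n∸[n∸a]≡a) (trans (cong (n ∸_) (trans (sym left) eq)) n∸g≡g))
        ... | inj₂ right = a≢g (trans (sym right) eq)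

    crossing-< : ∀ i j → toℕ i ℕ.< toℕ j → Σ g (λ b → indicator (crossing i j b)) ≤ edgeCost n c i j
    crossing-< i j i<j = subst₂ (λ v e → Σ g (λ b → indicator (crosses (toℕ b) (toℕ i) v)) ≤ e)
      i+a≡j (trans (sym (edgeCost-rot a i 0<a a<n)) (cong (edgeCost n c i) rot≡j))
      (crossing-rot a i 0<a (subst (ℕ._< n) (sym i+a≡j) (Fin.toℕ<n j)))
      where
      a = toℕ j ∸ toℕ i
      i+a≡j : toℕ i ℕ.+ a ≡ toℕ j
      i+a≡j = ℕ.m+[n∸m]≡n (ℕ.<⇒≤ i<j)
      0<a : 0 ℕ.< a
      0<a = ℕ.m<n⇒0<n∸m i<j
      a<n : a ℕ.< n
      a<n = ℕ.≤-<-trans (ℕ.m∸n≤m (toℕ j) (toℕ i)) (Fin.toℕ<n j)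
      rot≡j : rot a i ≡ j
      rot≡j = trans (cong (_mod n) i+a≡j) (mod-toℕ n j)

    crossing-≤-cost : ∀ i j → i ≢ j → Σ g (λ b → indicator (crossing i j b)) ≤ edgeCost n c i j
    crossing-≤-cost i j i≢j with ℕ.<-cmp (toℕ i) (toℕ j)
    ... | tri< i<j _ _ = crossing-< i j i<j
    ... | tri≈ _ i≡j _ = ⊥-elim (i≢j (Fin.toℕ-injective i≡j))
    ... | tri> _ _ j<i = subst₂ _≤_
      (Σ-cong g (λ b → cong indicator (crosses-sym (toℕ b) (toℕ j) (toℕ i))))
      (cong (stripeCost (n ℕ./ 2) c) (stripe-sym n j i))
      (crossing-< j i j<i)

    module _ (σ : Permutation′ n) where

      crossed : Fin g → Fin n → Bool
      crossed b k = crossing (σ ⟨$⟩ʳ k) (σ ⟨$⟩ʳ next k) b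

      crossings : Fin g → ℚ
      crossings b = Σ n (λ k → indicator (crossed b k))

      crossed-even : ∀ b → xorΣ n (crossed b) ≡ false
      crossed-even b = trans (xorΣ-cyclic n (λ k → colour (toℕ b) (toℕ (σ ⟨$⟩ʳ k)))) n-even

      crossed⇒2≤ : ∀ b → ∃ (λ k → crossed b k ≡ true) → 2ℚ ≤ crossings b
      crossed⇒2≤ b = even∧nonzero⇒2≤Σ n (crossed b) (crossed-even b)

      -- If neither gap is crossed, the two colourings change at exactly the same steps, so their
      -- difference is constant on all vertices. The parities cancel in it, and what remains marks
      -- the rungs from `b + 1` to `b′`: it holds at `b + 1` and fails at `b′ + 1`. This covers
      -- arbitrary chords too, since `crosses` is defined through the colourings alone.
      connected : ∀ b b′ → toℕ b ℕ.< toℕ b′ →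
        ∃ (λ k → crossed b k ≡ true) ⊎ ∃ (λ k → crossed b′ k ≡ true)
      connected b b′ b<b′ with Fin.any? (λ k → crossed b k Bool.≟ true) | Fin.any? (λ k → crossed b′ k Bool.≟ true)
      ... | yes some | _        = inj₁ some
      ... | no _     | yes some = inj₂ some
      ... | no none  | no none′ = ⊥-elim (clash inner outer)
        where
        β = toℕ b
        β′ = toℕ b′
        β′<g = Fin.toℕ<n b′
        differ : ℕ → Bool
        differ u = colour β u xor colour β′ u
        open xor-∧-Solver renaming (solve to solveᵇ; _:+_ to _⊕_; _:=_ to _≈_; con to conᵇ)
        differ-arc : ∀ u → differ u ≡ arc β u xor arc β′ u
        differ-arc u = solveᵇ 3 (λ a a′ p → (a ⊕ p) ⊕ (a′ ⊕ p) ≈ a ⊕ a′) refl (arc β u) (arc β′ u) (parity u)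
        balance : ∀ p q r s → not (p xor q) ≡ not (r xor s) → p xor r ≡ q xor s
        balance p q r s eq = trans
          (solveᵇ 4 (λ p q r s → p ⊕ r ≈ (conᵇ true ⊕ (p ⊕ q)) ⊕ (q ⊕ (conᵇ true ⊕ r))) refl p q r s)
          (trans (cong (_xor (q xor not r)) eq)
            (solveᵇ 4 (λ p q r s → (conᵇ true ⊕ (r ⊕ s)) ⊕ (q ⊕ (conᵇ true ⊕ r)) ≈ q ⊕ s) refl p q r s))
        step : ∀ k → differ (toℕ (σ ⟨$⟩ʳ k)) ≡ differ (toℕ (σ ⟨$⟩ʳ next k))
        step k = balance (colour β (toℕ (σ ⟨$⟩ʳ k))) (colour β (toℕ (σ ⟨$⟩ʳ next k)))
                         (colour β′ (toℕ (σ ⟨$⟩ʳ k))) (colour β′ (toℕ (σ ⟨$⟩ʳ next k)))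
          (trans (Bool.¬-not (λ eq → none (k , eq))) (sym (Bool.¬-not (λ eq → none′ (k , eq)))))
        constant : ∀ i j → differ (toℕ i) ≡ differ (toℕ j)
        constant i j = subst₂ (λ i j → differ (toℕ i) ≡ differ (toℕ j)) (inverseʳ σ) (inverseʳ σ)
          (next-invariant⇒const n (λ k → differ (toℕ (σ ⟨$⟩ʳ k))) step (σ ⟨$⟩ˡ i) (σ ⟨$⟩ˡ j))
        constant-< : ∀ {u v} → u ℕ.< n → v ℕ.< n → differ u ≡ differ v
        constant-< u<n v<n = subst₂ (λ u v → differ u ≡ differ v) (Fin.toℕ-fromℕ< u<n) (Fin.toℕ-fromℕ< v<n)
          (constant (fromℕ< u<n) (fromℕ< v<n))
        inner : differ (suc β) ≡ true
        inner = trans (differ-arc (suc β)) (cong₂ _xor_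
          (arc-inside (ℕ.n<1+n β) (ℕ.≤-trans (ℕ.≤-reflexive (ℕ.+-comm 1 β)) (ℕ.+-monoʳ-≤ β (ℕ.<⇒≤ 1<g))))
          (arc-below b<b′))
        outer : differ (suc β) ≡ false
        outer = trans (constant-< (ℕ.≤-<-trans b<b′ (ℕ.<-trans β′<g g<n)) (ℕ.≤-<-trans β′<g g<n))
          (trans (differ-arc (suc β′)) (cong₂ _xor_
            (arc-inside (ℕ.m<n⇒m<1+n b<b′) (ℕ.≤-trans β′<g (ℕ.m≤n+m g β)))
            (arc-inside (ℕ.n<1+n β′) (ℕ.≤-trans (ℕ.≤-reflexive (ℕ.+-comm 1 β′)) (ℕ.+-monoʳ-≤ β′ (ℕ.<⇒≤ 1<g))))))

      alternative : ∀ b b′ → b ≢ b′ → 2ℚ ≤ crossings b ⊎ 2ℚ ≤ crossings b′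
      alternative b b′ b≢b′ with ℕ.<-cmp (toℕ b) (toℕ b′)
      ... | tri< b<b′ _ _ = Data.Sum.map (crossed⇒2≤ b) (crossed⇒2≤ b′) (connected b b′ b<b′)
      ... | tri≈ _ eq _   = ⊥-elim (b≢b′ (Fin.toℕ-injective eq))
      ... | tri> _ _ b′<b = Data.Sum.swap (Data.Sum.map (crossed⇒2≤ b′) (crossed⇒2≤ b) (connected b′ b b′<b))

      tour-lower-bound : ι g * 2ℚ ≤ tourCost n c σ + 2ℚ
      tour-lower-bound = begin
        ι g * 2ℚ                ≤⟨ all-but-one g crossings (λ b → Σ-nonneg n (λ k → indicator-nonneg (crossed b k))) alternative ⟩
        Σ g crossings + 2ℚ      ≡⟨ cong (_+ 2ℚ) (Σ-swap g n (λ b k → indicator (crossed b k))) ⟩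
        Σ n (λ k → Σ g (λ b → indicator (crossed b k))) + 2ℚ
          ≤⟨ ℚ.+-monoˡ-≤ 2ℚ (Σ-mono n (λ k → crossing-≤-cost _ _ (distinct k))) ⟩
        tourCost n c σ + 2ℚ     ∎
        where
        open ℚ.≤-Reasoning
        distinct : ∀ k → (σ ⟨$⟩ʳ k) ≢ (σ ⟨$⟩ʳ next k)
        distinct k eq = next-≢ n 1<n k (trans (sym (inverseˡ σ)) (trans (cong (σ ⟨$⟩ˡ_) eq) (inverseˡ σ)))

    -- The LP solution

    at : Fin n → Fin n → Bool
    at k j = toℕ j ℕ.≡ᵇ toℕ k

    at-true : ∀ {j k} → at k j ≡ true → j ≡ k
    at-true eq = Fin.toℕ-injective (≡ᵇ≡true⇒≡ eq)

    at-refl : ∀ {j k} → j ≡ k → at k j ≡ true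
    at-refl eq = ≡⇒≡ᵇ≡true (cong toℕ eq)

    at-≢ : ∀ {j k} → j ≢ k → at k j ≡ false
    at-≢ j≢k = ≢⇒≡ᵇ≡false (λ eq → j≢k (Fin.toℕ-injective eq))

    rot-inverse : ∀ a b → a ℕ.+ b ≡ n → ∀ i → rot b (rot a i) ≡ i
    rot-inverse a b a+b≡n i = trans (rot-rot a b i) (trans (cong (λ s → rot s i) a+b≡n) (trans (rot-n 0 i) (rot-0 i)))

    at-flip : ∀ a b → a ℕ.+ b ≡ n → ∀ i j → at (rot a i) j ≡ at (rot b j) i
    at-flip a b a+b≡n i j with at (rot a i) j in eq
    ... | true  = sym (at-refl (trans (sym (rot-inverse a b a+b≡n i)) (cong (rot b) (sym (at-true eq)))))
    ... | false = sym (at-≢ (λ i≡ → clash (at-refl (trans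
      (sym (rot-inverse b a (trans (ℕ.+-comm b a) a+b≡n) j)) (cong (rot a) (sym i≡)))) eq))

    weight : Bool → Bool → Bool → ℚ
    weight p q r = (if p then ½ else 0ℚ) + ((if q then ½ else 0ℚ) + (if r then 1ℚ else 0ℚ))

    x : LPPoint n
    x i j = weight (at (rot 1 i) j) (at (rot (n ∸ 1) i) j) (at (rot g i) j)

    -- One formula for three uses: `f` is constant for the degrees, the indicator of the pairs
    -- leaving `S` for the cuts, and the edge cost for the objective.
    row-sum : ∀ i (f : Fin n → ℚ) →
      Σ n (λ j → f j * x i j) ≡ f (rot 1 i) * ½ + (f (rot (n ∸ 1) i) * ½ + f (rot g i))
    row-sum i f = begin
      Σ n (λ j → f j * x i j)
        ≡⟨ Σ-cong n (λ j → trans (ℚ.*-distribˡ-+ (f j) (X₁ j) (X₂ j + X₃ j))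
             (cong (f j * X₁ j +_) (ℚ.*-distribˡ-+ (f j) (X₂ j) (X₃ j)))) ⟩
      Σ n (λ j → f j * X₁ j + (f j * X₂ j + f j * X₃ j))
        ≡⟨ trans (Σ-+ n (λ j → f j * X₁ j) (λ j → f j * X₂ j + f j * X₃ j))
             (cong (Σ n (λ j → f j * X₁ j) +_) (Σ-+ n (λ j → f j * X₂ j) (λ j → f j * X₃ j))) ⟩
      Σ n (λ j → f j * X₁ j) + (Σ n (λ j → f j * X₂ j) + Σ n (λ j → f j * X₃ j))
        ≡⟨ cong₂ _+_ (pick ½ (rot 1 i)) (cong₂ _+_ (pick ½ (rot (n ∸ 1) i))
             (trans (pick 1ℚ (rot g i)) (ℚ.*-identityʳ (f (rot g i))))) ⟩
      f (rot 1 i) * ½ + (f (rot (n ∸ 1) i) * ½ + f (rot g i)) ∎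
      where
      open ≡-Reasoning
      X₁ X₂ X₃ : Fin n → ℚ
      X₁ j = if at (rot 1 i) j then ½ else 0ℚ
      X₂ j = if at (rot (n ∸ 1) i) j then ½ else 0ℚ
      X₃ j = if at (rot g i) j then 1ℚ else 0ℚ
      pick : ∀ q k → Σ n (λ j → f j * (if at k j then q else 0ℚ)) ≡ f k * q
      pick q k = trans
        (Σ-single n _ k (λ j j≢k → trans (cong (λ b → f j * (if b then q else 0ℚ)) (at-≢ j≢k)) (ℚ.*-zeroʳ (f j))))
        (cong (λ b → f k * (if b then q else 0ℚ)) (at-refl {k} refl))

    out : (Fin n → Bool) → ℕ → Fin n → Bool
    out S a i = S i ∧ not (S (rot a i))

    module _ (S : Fin n → Bool) where

      outgoing : ℕ → ℚ
      outgoing a = Σ n (λ i → indicator (out S a i))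

      cut-outgoing : cut n x S ≡ outgoing 1 * ½ + (outgoing (n ∸ 1) * ½ + outgoing g)
      cut-outgoing = begin
        cut n x S
          ≡⟨ Σ-cong n (λ i → trans (Σ-cong n (λ j → if-indicator (S i ∧ not (S j)) (x i j)))
               (row-sum i (λ j → indicator (S i ∧ not (S j))))) ⟩
        Σ n (λ i → I 1 i * ½ + (I (n ∸ 1) i * ½ + I g i))
          ≡⟨ trans (Σ-+ n (λ i → I 1 i * ½) (λ i → I (n ∸ 1) i * ½ + I g i))
               (cong (Σ n (λ i → I 1 i * ½) +_) (Σ-+ n (λ i → I (n ∸ 1) i * ½) (I g))) ⟩
        Σ n (λ i → I 1 i * ½) + (Σ n (λ i → I (n ∸ 1) i * ½) + outgoing g)
          ≡⟨ cong₂ (λ s t → s + (t + outgoing g)) (halve 1) (halve (n ∸ 1)) ⟩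
        outgoing 1 * ½ + (outgoing (n ∸ 1) * ½ + outgoing g) ∎
        where
        open ≡-Reasoning
        I : ℕ → Fin n → ℚ
        I a i = indicator (out S a i)
        halve : ∀ a → Σ n (λ i → I a i * ½) ≡ outgoing a * ½
        halve a = trans (Σ-cong n (λ i → ℚ.*-comm (I a i) ½))
          (trans (Σ-*ˡ n ½ (I a)) (ℚ.*-comm ½ (outgoing a)))

      outgoing-≥1 : ∀ a → ∃ (λ i → out S a i ≡ true) → 1ℚ ≤ outgoing a
      outgoing-≥1 a (i , eq) = ℚ.≤-trans (indicator-true eq)
        (Σ-≥-term n (λ i → indicator-nonneg (out S a i)) i)

      leaves : ∀ a i → S i ≡ true → S (rot a i) ≡ false → out S a i ≡ true
      leaves a i Sᵢ Sᵣ = cong₂ (λ p q → p ∧ not q) Sᵢ Sᵣ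

      stays : ∀ a i → out S a i ≡ false → S i ≡ true → S (rot a i) ≡ true
      stays a i eq Sᵢ = trans (sym (Bool.not-involutive _)) (cong not (trans (cong (_∧ not (S (rot a i))) (sym Sᵢ)) eq))

      -- The rotations by multiples of `a` lead from inside `S` to outside, so some single rotation
      -- leaves it.
      outgoing-exists : ∀ a i k → S i ≡ true → S ((toℕ i ℕ.+ k ℕ.* a) mod n) ≡ false → ∃ λ i → out S a i ≡ true
      outgoing-exists a i k Sᵢ Sₖ with descent (λ m → S ((toℕ i ℕ.+ m ℕ.* a) mod n)) k
                                        (trans (cong S (rot-0 i)) Sᵢ) Sₖ
      ... | m , Sₘ , Sₘ₊₁ = v , leaves a v Sₘ (trans (cong S rot-v) Sₘ₊₁)
        where
        v = (toℕ i ℕ.+ m ℕ.* a) mod n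
        rot-v : rot a v ≡ (toℕ i ℕ.+ suc m ℕ.* a) mod n
        rot-v = trans (rot-rot (m ℕ.* a) a i) (cong (λ s → rot s i) (ℕ.+-comm (m ℕ.* a) a))

      -- If no diameter leaves S, then S is invariant under the half turn, and so is its boundary.
      outgoing-doubled : (∀ i → out S g i ≡ false) → ∀ a → ∃ (λ i → out S a i ≡ true) → 2ℚ ≤ outgoing a
      outgoing-doubled none a (i , eq) = ℚ.≤-trans
        (ℚ.+-mono-≤ (indicator-true eq) (indicator-true opposite))
        (Σ-≥-two-terms n (λ i → indicator-nonneg (out S a i)) (rot-≢ i (ℕ.<-trans ℕ.z<s 1<g) g<n))
        where
        Sᵢ : S i ≡ true
        Sᵢ = Bool.∧-conicalˡ (S i) _ eq
        Sᵣ : S (rot a i) ≡ false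
        Sᵣ = trans (sym (Bool.not-involutive _)) (cong not (Bool.∧-conicalʳ (S i) _ eq))
        half-turn : rot g (rot a (rot g i)) ≡ rot a i
        half-turn = trans (cong (rot g) (rot-rot g a i)) (trans (rot-rot (g ℕ.+ a) g i)
          (trans (cong (λ s → rot s i) (trans (cong (ℕ._+ g) (ℕ.+-comm g a)) (trans (ℕ.+-assoc a g g) (cong (a ℕ.+_) (sym n≡)))))
            (rot-n a i)))
        opposite : out S a (rot g i) ≡ true
        opposite = leaves a (rot g i) (stays g i (none i) Sᵢ) (Bool.¬-not (λ Sₒ →
          clash (trans (cong S (sym half-turn)) (stays g (rot a (rot g i)) (none _) Sₒ)) Sᵣ))

      -- The cycle leaves `S` at least once in each direction, which gives `½ + ½`. The missing 1
      -- comes from a diameter leaving `S`, or else from the half turn, which doubles both exits.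
      cut-lower-bound : ∃ (λ i → S i ≡ true) → ∃ (λ j → S j ≡ false) → 2ℚ ≤ cut n x S
      cut-lower-bound (i , Sᵢ) (j , Sⱼ) = subst (2ℚ ≤_) (sym cut-outgoing) (cases (Fin.any? (λ v → out S g v Bool.≟ true)))
        where
        forwards : ∃ λ v → out S 1 v ≡ true
        forwards = outgoing-exists 1 i (toℕ j ℕ.+ (n ∸ toℕ i)) Sᵢ (trans (cong S target) Sⱼ)
          where
          target : (toℕ i ℕ.+ (toℕ j ℕ.+ (n ∸ toℕ i)) ℕ.* 1) mod n ≡ j
          target = trans (Cong⇒mod≡ n (Cong-trans (Cong-reflexive (begin
            toℕ i ℕ.+ (toℕ j ℕ.+ (n ∸ toℕ i)) ℕ.* 1  ≡⟨ cong (toℕ i ℕ.+_) (ℕ.*-identityʳ _) ⟩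
            toℕ i ℕ.+ (toℕ j ℕ.+ (n ∸ toℕ i))        ≡⟨ N.solve 3 (λ i j k → i N.:+ (j N.:+ k) N.:= j N.:+ (i N.:+ k)) refl (toℕ i) (toℕ j) (n ∸ toℕ i) ⟩
            toℕ j ℕ.+ (toℕ i ℕ.+ (n ∸ toℕ i))        ≡⟨ cong (toℕ j ℕ.+_) (ℕ.m+[n∸m]≡n (ℕ.<⇒≤ (Fin.toℕ<n i))) ⟩
            toℕ j ℕ.+ n ∎)) (Cong-+-modulus (toℕ j)))) (mod-toℕ n j)
            where
            open ≡-Reasoning
        backwards : ∃ λ v → out S (n ∸ 1) v ≡ true
        backwards = outgoing-exists (n ∸ 1) i t Sᵢ (trans (cong S target) Sⱼ)
          where
          open ≡-Reasoning
          -- Adding `n ∸ 1` is a step back, and `t` is congruent to `i - j`.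
          t = toℕ i ℕ.+ (n ∸ toℕ j)
          target : (toℕ i ℕ.+ t ℕ.* (n ∸ 1)) mod n ≡ j
          target = trans (Cong⇒mod≡ n (Cong-+-cancel t (cong-mod 1 t (begin
            (toℕ i ℕ.+ t ℕ.* (n ∸ 1) ℕ.+ t) ℕ.+ 1 ℕ.* n
              ≡⟨ N.solve 4 (λ i t p n → (i N.:+ t N.:* p N.:+ t) N.:+ N.con 1 N.:* n N.:= (i N.:+ n) N.:+ t N.:* (N.con 1 N.:+ p))
                   refl (toℕ i) t (n ∸ 1) n ⟩
            (toℕ i ℕ.+ n) ℕ.+ t ℕ.* suc (n ∸ 1)
              ≡⟨ cong₂ (λ s m → s ℕ.+ t ℕ.* m) around (ℕ.suc-pred n) ⟩
            (toℕ j ℕ.+ t) ℕ.+ t ℕ.* n ∎)))) (mod-toℕ n j)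
            where
            around : toℕ i ℕ.+ n ≡ toℕ j ℕ.+ t
            around = trans (cong (toℕ i ℕ.+_) (sym (ℕ.m+[n∸m]≡n (ℕ.<⇒≤ (Fin.toℕ<n j)))))
              (N.solve 3 (λ i j k → i N.:+ (j N.:+ k) N.:= j N.:+ (i N.:+ k)) refl (toℕ i) (toℕ j) (n ∸ toℕ j))
        cases : Dec (∃ λ v → out S g v ≡ true) → 2ℚ ≤ outgoing 1 * ½ + (outgoing (n ∸ 1) * ½ + outgoing g)
        cases (yes some) = ℚ.+-mono-≤ {1ℚ * ½}
          (ℚ.*-monoʳ-≤-nonNeg ½ (outgoing-≥1 1 forwards))
          (ℚ.+-mono-≤ (ℚ.*-monoʳ-≤-nonNeg ½ (outgoing-≥1 (n ∸ 1) backwards)) (outgoing-≥1 g some))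
        cases (no none) = ℚ.+-mono-≤ {2ℚ * ½}
          (ℚ.*-monoʳ-≤-nonNeg ½ (outgoing-doubled diameters 1 forwards))
          (ℚ.+-mono-≤ (ℚ.*-monoʳ-≤-nonNeg ½ (outgoing-doubled diameters (n ∸ 1) backwards))
            (Σ-nonneg n (λ v → indicator-nonneg (out S g v))))
          where
          diameters : ∀ v → out S g v ≡ false
          diameters v = Bool.¬-not (λ eq → none (v , eq))

    1+[n∸1]≡n : 1 ℕ.+ (n ∸ 1) ≡ n
    1+[n∸1]≡n = ℕ.m+[n∸m]≡n (ℕ.<⇒≤ 1<n)

    0<g : 0 ℕ.< g
    0<g = ℕ.<-trans ℕ.z<s 1<g

    0<n∸1 : 0 ℕ.< n ∸ 1
    0<n∸1 = ℕ.<-trans 0<g g<n∸1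

    x-feasible : SubtourFeasible n x
    x-feasible = record
      { symmetric = x-sym
      ; diagonal  = x-diag
      ; lower     = λ i j → weight-nonneg (at (rot 1 i) j) (at (rot (n ∸ 1) i) j) (at (rot g i) j)
      -- Only a coincidence of a diameter with a cycle edge could exceed 1; it is excluded by
      -- `1 < g < n ∸ 1`.
      ; upper     = λ i j → weight-≤1 (at (rot 1 i) j) (at (rot (n ∸ 1) i) j) (at (rot g i) j)
          (λ p r → ℕ.<⇒≢ 1<g (rot-injective i 1<n g<n (trans (sym (at-true {j} p)) (at-true {j} r))))
          (λ q r → ℕ.<⇒≢ g<n∸1 (rot-injective i g<n n∸1<n (trans (sym (at-true {j} r)) (at-true {j} q))))
      ; degree    = λ v → trans (Σ-cong n (λ j → sym (ℚ.*-identityˡ (x v j)))) (row-sum v (λ _ → 1ℚ))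
      ; subtour   = cut-lower-bound
      }
      where
      x-sym : ∀ i j → x i j ≡ x j i
      x-sym i j = begin
        weight (at (rot 1 i) j) (at (rot (n ∸ 1) i) j) (at (rot g i) j)
          ≡⟨ cong₂ (λ p q → weight p q (at (rot g i) j)) (at-flip 1 (n ∸ 1) 1+[n∸1]≡n i j)
               (at-flip (n ∸ 1) 1 (trans (ℕ.+-comm (n ∸ 1) 1) 1+[n∸1]≡n) i j) ⟩
        weight (at (rot (n ∸ 1) j) i) (at (rot 1 j) i) (at (rot g i) j)
          ≡⟨ cong (weight (at (rot (n ∸ 1) j) i) (at (rot 1 j) i)) (at-flip g g (sym n≡) i j) ⟩
        weight (at (rot (n ∸ 1) j) i) (at (rot 1 j) i) (at (rot g j) i)
          ≡⟨ swap (if at (rot (n ∸ 1) j) i then ½ else 0ℚ) (if at (rot 1 j) i then ½ else 0ℚ) _ ⟩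
        weight (at (rot 1 j) i) (at (rot (n ∸ 1) j) i) (at (rot g j) i) ∎
        where
        open ≡-Reasoning
        swap : ∀ p q r → p + (q + r) ≡ q + (p + r)
        swap = solve 3 (λ p q r → p :+ (q :+ r) := q :+ (p :+ r)) refl
      x-diag : ∀ i → x i i ≡ 0ℚ
      x-diag i = begin
        x i i
          ≡⟨ cong₂ (λ p q → weight p q (at (rot g i) i)) (at-≢ (rot-≢ i ℕ.z<s 1<n)) (at-≢ (rot-≢ i 0<n∸1 n∸1<n)) ⟩
        weight false false (at (rot g i) i)
          ≡⟨ cong (weight false false) (at-≢ (rot-≢ i 0<g g<n)) ⟩
        0ℚ ∎
        where open ≡-Reasoning
      0≤½ : 0ℚ ≤ ½
      0≤½ = ℚ.nonNegative⁻¹ ½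
      weight-nonneg : ∀ p q r → 0ℚ ≤ weight p q r
      weight-nonneg p q r = +-nonneg (if-nonneg p (λ _ → 0≤½)) (+-nonneg (if-nonneg q (λ _ → 0≤½)) (if-nonneg r (λ _ → 0≤1)))
      weight-≤1 : ∀ p q r → (p ≡ true → r ≡ true → ⊥) → (q ≡ true → r ≡ true → ⊥) → weight p q r ≤ 1ℚ
      weight-≤1 true  _     true  ¬pr _   = ⊥-elim (¬pr refl refl)
      weight-≤1 false true  true  _   ¬qr = ⊥-elim (¬qr refl refl)
      weight-≤1 false false true  _   _   = from-yes (weight false false true ℚ.≤? 1ℚ)
      weight-≤1 true  true  false _   _   = from-yes (weight true true false ℚ.≤? 1ℚ)
      weight-≤1 true  false false _   _   = from-yes (weight true false false ℚ.≤? 1ℚ)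
      weight-≤1 false true  false _   _   = from-yes (weight false true false ℚ.≤? 1ℚ)
      weight-≤1 false false false _   _   = from-yes (weight false false false ℚ.≤? 1ℚ)

    lpCost-x : lpCost n c x ≡ ι g
    lpCost-x = begin
      lpCost n c x
        ≡⟨ solve 1 (λ l → l := con ½ :* ((con 1ℚ :+ con 1ℚ) :* l)) refl (lpCost n c x) ⟩
      ½ * (2ℚ * lpCost n c x)
        ≡⟨ cong (½ *_) (sym (Σ-edges n (λ i j → edgeCost n c i j * x i j)
             (λ i j → cong₂ _*_ (cong (stripeCost (n ℕ./ 2) c) (stripe-sym n i j)) (SubtourFeasible.symmetric x-feasible i j))
             (λ i → trans (cong (edgeCost n c i i *_) (SubtourFeasible.diagonal x-feasible i)) (ℚ.*-zeroʳ (edgeCost n c i i))))) ⟩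
      ½ * Σ n (λ i → Σ n (λ j → edgeCost n c i j * x i j))
        ≡⟨ cong (½ *_) (Σ-cong n row) ⟩
      ½ * Σ n (λ _ → 1ℚ)
        ≡⟨ cong (½ *_) (trans (Σ-const n 1ℚ) (trans (ℚ.*-identityʳ (ι n)) (trans (cong ι n≡) (ι-+ g g)))) ⟩
      ½ * (ι g + ι g)
        ≡⟨ solve 1 (λ l → con ½ :* (l :+ l) := l) refl (ι g) ⟩
      ι g ∎
      where
      open ≡-Reasoning
      row : ∀ i → Σ n (λ j → edgeCost n c i j * x i j) ≡ 1ℚ
      row i = trans (row-sum i (edgeCost n c i)) (cong₂ (λ p q → p * ½ + q) (cost 1 ℕ.z<s 1<n stripe₁)
        (cong₂ (λ p q → p * ½ + q) (cost (n ∸ 1) 0<n∸1 n∸1<n stripe₂)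
          (trans (edgeCost-rot g i 0<g g<n) (trans (cong price (trans (cong (_⊓ g) n∸g≡g) (ℕ.⊓-idem g))) price-g))))
        where
        stripe₁ : (n ∸ 1) ⊓ 1 ≡ 1
        stripe₁ = ℕ.m≥n⇒m⊓n≡n 0<n∸1
        stripe₂ : (n ∸ (n ∸ 1)) ⊓ (n ∸ 1) ≡ 1
        stripe₂ = trans (cong (_⊓ (n ∸ 1)) (ℕ.m∸[m∸n]≡n (ℕ.<⇒≤ 1<n))) (ℕ.m≤n⇒m⊓n≡m 0<n∸1)
        cost : ∀ a → 0 ℕ.< a → a ℕ.< n → (n ∸ a) ⊓ a ≡ 1 → edgeCost n c i (rot a i) ≡ 1ℚ
        cost a 0<a a<n eq = trans (edgeCost-rot a i 0<a a<n) (cong price eq)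

    -- The deficit 2 in the tour bound `2g - 2` is absorbed by `ε * g`.
    gap : ∀ ε → 2ℚ < ε * ι g → (σ : Permutation′ n) → (2ℚ - ε) * lpCost n c x < tourCost n c σ
    gap ε large σ = begin-strict
      (2ℚ - ε) * lpCost n c x          ≡⟨ cong ((2ℚ - ε) *_) lpCost-x ⟩
      (2ℚ - ε) * ι g                   ≡⟨ solve 3 (λ t e l → (t :- e) :* l := l :* t :- e :* l) refl 2ℚ ε (ι g) ⟩
      ι g * 2ℚ - ε * ι g               <⟨ ℚ.+-mono-≤-< (tour-lower-bound σ) (ℚ.neg-antimono-< large) ⟩
      (tourCost n c σ + 2ℚ) - 2ℚ       ≡⟨ solve 2 (λ s t → (s :+ t) :- t := s) refl (tourCost n c σ) 2ℚ ⟩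
      tourCost n c σ                   ∎
      where open ℚ.≤-Reasoning

-- Choice of the scale for a given `ε`, and the two bounds together.

open Sums
open Upper
open Lower
open import Data.Nat using (ℕ; _≤_; _/_)
import Data.Nat as ℕ
import Data.Nat.Properties as ℕ
open import Data.Fin using (Fin)
open import Data.Fin.Permutation using (Permutation′)
open import Data.Product using (_×_; Σ-syntax; ∃-syntax; _,_)
open import Data.Rational using (ℚ; 0ℚ; _*_; _-_; _<_) renaming (_≤_ to _≤ℚ_)
open import Data.Rational as ℚ using (mkℚ; 1ℚ; _+_; toℚᵘ)
import Data.Rational.Properties as ℚ
open import Data.Rational.Unnormalised as ℚᵘ using (mkℚᵘ; _≃_; *≡*; *≤*)
import Data.Rational.Unnormalised.Properties as ℚᵘ
open import Data.Integer as ℤ using (+_; +[1+_]; -[1+_])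
import Data.Integer.Properties as ℤ
open import Relation.Binary.PropositionalEquality
open import Relation.Nullary.Decidable using (from-yes)
open import Data.Rational.Solver using (module +-*-Solver)
open +-*-Solver using (solve; _:+_; _:*_; _:=_)

toℚᵘ-ι : ∀ m → toℚᵘ (ι m) ≃ mkℚᵘ (+ m) 0
toℚᵘ-ι ℕ.zero    = ℚᵘ.≃-refl
toℚᵘ-ι (ℕ.suc m) = ℚᵘ.≃-trans (ℚ.toℚᵘ-homo-+ 1ℚ (ι m))
  (ℚᵘ.≃-trans (ℚᵘ.+-congʳ (toℚᵘ 1ℚ) (toℚᵘ-ι m)) (*≡* (cong (λ k → (+ 1 ℤ.+ k) ℤ.* + 1) (ℤ.*-identityʳ (+ m)))))

-- The denominator of `ε` serves as `m`: the product is then the positive numerator.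
archimedean : ∀ ε → 0ℚ < ε → Σ[ m ∈ ℕ ] (1 ≤ m × 1ℚ ≤ℚ ε * ι m)
archimedean (mkℚ (+ 0) d c) 0<ε with () ← ℚ.positive 0<ε
archimedean (mkℚ -[1+ k ] d c) 0<ε with () ← ℚ.positive 0<ε
archimedean ε@(mkℚ +[1+ k ] d c) 0<ε = ℕ.suc d , ℕ.s≤s ℕ.z≤n , ℚ.toℚᵘ-cancel-≤
  (ℚᵘ.≤-respʳ-≃ (ℚᵘ.≃-sym (ℚᵘ.≃-trans (ℚ.toℚᵘ-homo-* ε (ι (ℕ.suc d))) (ℚᵘ.*-congˡ {toℚᵘ ε} (toℚᵘ-ι (ℕ.suc d)))))
    (*≤* (ℤ.+≤+ (ℕ.s≤s (subst₂ _≤_ (sym (trans (ℕ.+-identityʳ (d ℕ.* 1)) (ℕ.*-identityʳ d))) (sym (ℕ.*-identityʳ _))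
      (ℕ.m≤m+n d (k ℕ.* ℕ.suc d)))))))

-- Comparing with every feasible point bounds the ratio to the LP optimum without its being
-- attained. Conversely, a single feasible point bounds that optimum from above, so it suffices for
-- the lower bound. Products instead of quotients avoid a vanishing denominator.
theorem4 : ((n : ℕ) → 3 ≤ n → (c : Fin (n / 2) → ℚ) → (∀ k → 0ℚ ≤ℚ c k) →
    (x : LPPoint n) → SubtourFeasible n x →
    ∃[ σ ] (tourCost n c σ ≤ℚ 2ℚ * lpCost n c x))
    ×
    ((ε : ℚ) → 0ℚ < ε →
    Σ[ n ∈ ℕ ] (3 ≤ n × Σ[ c ∈ (Fin (n / 2) → ℚ) ] ((∀ k → 0ℚ ≤ℚ c k) ×
    Σ[ x ∈ LPPoint n ] (SubtourFeasible n x ×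
    ((σ : Permutation′ n) → (2ℚ - ε) * lpCost n c x < tourCost n c σ)))))
theorem4 = upper , lower
  where
  upper = λ n 3≤n c c≥0 x feasible →
    UpperBound.upper-bound n {{ℕ.>-nonZero (ℕ.≤-trans (ℕ.s≤s ℕ.z≤n) 3≤n)}} c c≥0 x feasible (ℕ.≤-trans (ℕ.n≤1+n 2) 3≤n)
  lower : (ε : ℚ) → 0ℚ < ε →
    Σ[ n ∈ ℕ ] (3 ≤ n × Σ[ c ∈ (Fin (n / 2) → ℚ) ] ((∀ k → 0ℚ ≤ℚ c k) ×
    Σ[ x ∈ LPPoint n ] (SubtourFeasible n x ×
    ((σ : Permutation′ n) → (2ℚ - ε) * lpCost n c x < tourCost n c σ))))
  lower ε 0<ε = from-scale (archimedean ε 0<ε)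
    where
    from-scale : Σ[ m ∈ ℕ ] (1 ≤ m × 1ℚ ≤ℚ ε * ι m) → _
    from-scale (m , 1≤m , 1≤εm) = n , ℕ.≤-trans 2<g (ℕ.m≤m+n g g) , c , c-nonneg , x , x-feasible , gap ε large
      where
      h = m ℕ.+ m
      -- `g = 4m` is even, exceeds 2, and gives `ε * g ≥ 4`; with `2m` the required strict
      -- inequality `2 < ε * g` could fail.
      g = h ℕ.+ h
      n = g ℕ.+ g
      2<g : 2 ℕ.< g
      2<g = ℕ.≤-trans (ℕ.n≤1+n 3) (ℕ.+-mono-≤ (ℕ.+-mono-≤ 1≤m 1≤m) (ℕ.+-mono-≤ 1≤m 1≤m))
      open MobiusLadder n g {{ℕ.>-nonZero (ℕ.≤-trans (ℕ.s≤s ℕ.z≤n) (ℕ.≤-trans 2<g (ℕ.m≤m+n g g)))}} refl (parity-double h) 2<g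
      large : 2ℚ < ε * ι g
      large = ℚ.<-≤-trans (from-yes (2ℚ ℚ.<? (1ℚ + 1ℚ) + (1ℚ + 1ℚ)))
        (ℚ.≤-trans (ℚ.+-mono-≤ (ℚ.+-mono-≤ 1≤εm 1≤εm) (ℚ.+-mono-≤ 1≤εm 1≤εm)) (ℚ.≤-reflexive (sym expand)))
        where
        expand : ε * ι g ≡ (ε * ι m + ε * ι m) + (ε * ι m + ε * ι m)
        expand = trans (cong (ε *_) (trans (ι-+ h h) (cong₂ _+_ (ι-+ m m) (ι-+ m m))))
          (solve 2 (λ e m → e :* ((m :+ m) :+ (m :+ m)) := (e :* m :+ e :* m) :+ (e :* m :+ e :* m)) refl ε (ι m))
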